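{- Let $T = T(x) > 0$, and let $$M(s) = \sum_{m \sim M} a_m m^{ -s}, \qquad N(s) = \sum_{n \sim N} b_n n^{ -s}$$ be two Dirichlet polynomials with $0 \le a_m \le 1$, $0 \le b_n \le 1$ (where $M, N$ may depend on $x$). Suppose that for an absolute constant $c$, $$\sum_{\substack{\rho \\ \beta \ge \sigma,\ |\gamma| \le T}} \left| M(\rho) N(\rho) \right| \ll x^{1-\sigma} (\log x)^{c}$$ uniformly for $0 \le \sigma \le 1$. Then $$\sum_{\substack{\rho \\ |\gamma| \le T}} x^{\beta - 1} \left| M(\rho) N(\rho) \right| \ll (\log x)^{c+1}.$$ Here the sums are over non-trivial zeroes $\rho = \beta + i\gamma$ of the Riemann zeta function satisfying the indicated conditions.
   Context: The notation $m \sim M$ means $M \le m < 2M$, with $m$ an integer. Both bounds are for large $x$; "uniformly" means the implied constant in the hypothesis does not depend on $\sigma$. Sums over zeroes count multiplicity. -}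

module Defs where

open import Level using (0ℓ)
open import Algebra.Bundles.Raw using (RawRing)
open import Algebra.Structures using (IsCommutativeRing)
import Algebra.Definitions.RawSemiring as RawSemiringDefs
open import Axiom.ExcludedMiddle using (ExcludedMiddle)
open import Data.Bool.Base using (if_then_else_)
open import Data.List.Base using (List; map; foldr)
open import Data.List.Relation.Unary.All using (All)
open import Data.List.Relation.Unary.Unique.Propositional using (Unique)
open import Data.Nat.Base as ℕ using (ℕ; zero; suc; _!)
open import Data.Product.Base using (Σ; ∃; ∃-syntax; _×_; _,_; proj₁; proj₂)
open import Relation.Binary.PropositionalEquality using (_≡_; _≢_)
open import Relation.Binary.Structures using (IsTotalOrder)
open import Relation.Nullary.Decidable.Core using (yes; no; does)

-- The real numbers are an arbitrary complete ordered field: these axioms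
-- determine them up to a unique isomorphism.

record CompleteOrderedField : Set₁ where
  infix  4 _≤_ _<_
  infixl 6 _+_ _-_
  infixl 7 _*_
  infix  8 -_
  infix  9 _⁻¹
  field
    ℝ   : Set
    _+_ : ℝ → ℝ → ℝ
    _*_ : ℝ → ℝ → ℝ
    -_  : ℝ → ℝ
    _⁻¹ : ℝ → ℝ
    0#  : ℝ
    1#  : ℝ
    _≤_ : ℝ → ℝ → Set

    isCommutativeRing : IsCommutativeRing _≡_ _+_ _*_ -_ 0# 1#
    0≢1               : 0# ≢ 1#
    -- The value of 0# ⁻¹ is unspecified.
    ⁻¹-inverseʳ       : ∀ x → x ≢ 0# → x * x ⁻¹ ≡ 1#

    isTotalOrder      : IsTotalOrder _≡_ _≤_
    +-monoˡ-≤         : ∀ z {x y} → x ≤ y → x + z ≤ y + z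
    *-nonneg          : ∀ {x y} → 0# ≤ x → 0# ≤ y → 0# ≤ x * y

  _<_ : ℝ → ℝ → Set
  x < y = x ≤ y × x ≢ y

  _-_ : ℝ → ℝ → ℝ
  x - y = x + (- y)

  IsUpperBound : (ℝ → Set) → ℝ → Set
  IsUpperBound P b = ∀ t → P t → t ≤ b

  IsLub : (ℝ → Set) → ℝ → Set
  IsLub P s = IsUpperBound P s × (∀ b → IsUpperBound P b → s ≤ b)

  field
    complete : ∀ (P : ℝ → Set) → ∃ P → ∃ (IsUpperBound P) → ∃ (IsLub P)

-- Excluded middle makes the usual classical definitions of limits, suprema
-- and inverse functions available as total functions.

module Analysis (lem : ExcludedMiddle 0ℓ) (R : CompleteOrderedField) where
  open CompleteOrderedField R public

  -- An element satisfying P, or the default d if there is none.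
  choose : {A : Set} → (A → Set) → A → A
  choose P d with lem {∃ P}
  ... | yes (a , _) = a
  ... | no  _       = d

  sup : (ℝ → Set) → ℝ
  sup P = choose (IsLub P) 0#

  ℝ-rawRing : RawRing 0ℓ 0ℓ
  ℝ-rawRing = record
    { Carrier = ℝ ; _≈_ = _≡_ ; _+_ = _+_ ; _*_ = _*_ ; -_ = -_
    ; 0# = 0# ; 1# = 1# }

  open RawSemiringDefs (RawRing.rawSemiring ℝ-rawRing) public
    using () renaming (_×_ to _×ℕ_)

  fromℕ : ℕ → ℝ
  fromℕ n = n ×ℕ 1#

  2# : ℝ
  2# = 1# + 1#

  ∣_∣ : ℝ → ℝ
  ∣ x ∣ = if does (lem {0# ≤ x}) then x else - x

  √_ : ℝ → ℝ
  √ x = sup (λ t → t * t ≤ x)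

  ----------------------------------------------------------------------
  -- Complex numbers

  infix 5 _+i_

  record ℂ : Set where
    constructor _+i_
    field
      re : ℝ
      im : ℝ

  open ℂ public

  infixl 6 _+ᶜ_ _-ᶜ_
  infixl 7 _*ᶜ_
  infix  8 -ᶜ_

  ofℝ : ℝ → ℂ
  ofℝ x = x +i 0#

  0ᶜ 1ᶜ : ℂ
  0ᶜ = ofℝ 0#
  1ᶜ = ofℝ 1#

  _+ᶜ_ : ℂ → ℂ → ℂ
  z +ᶜ w = (re z + re w) +i (im z + im w)

  _*ᶜ_ : ℂ → ℂ → ℂ
  z *ᶜ w = (re z * re w - im z * im w) +i (re z * im w + im z * re w)

  -ᶜ_ : ℂ → ℂ
  -ᶜ z = (- re z) +i (- im z)

  _-ᶜ_ : ℂ → ℂ → ℂ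
  z -ᶜ w = z +ᶜ (-ᶜ w)

  ℂ-rawRing : RawRing 0ℓ 0ℓ
  ℂ-rawRing = record
    { Carrier = ℂ ; _≈_ = _≡_ ; _+_ = _+ᶜ_ ; _*_ = _*ᶜ_ ; -_ = -ᶜ_
    ; 0# = 0ᶜ ; 1# = 1ᶜ }

  open RawSemiringDefs (RawRing.rawSemiring ℂ-rawRing) public
    using () renaming (_^_ to _^ᶜ_)

  ∥_∥ : ℂ → ℝ
  ∥ z ∥ = √ (re z * re z + im z * im z)

  -- sum< n f = f 0 + … + f (n - 1)
  sum< : ℕ → (ℕ → ℂ) → ℂ
  sum< zero    f = 0ᶜ
  sum< (suc n) f = sum< n f +ᶜ f n

  ----------------------------------------------------------------------
  -- Limits and derivatives

  _⟶_ : (ℕ → ℂ) → ℂ → Set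
  u ⟶ l = ∀ ε → 0# < ε → ∃[ N ] ∀ n → N ℕ.≤ n → ∥ u n -ᶜ l ∥ < ε

  lim : (ℕ → ℂ) → ℂ
  lim u = choose (u ⟶_) 0ᶜ

  HasDerivative : (ℂ → ℂ) → ℂ → ℂ → Set
  HasDerivative f s d =
    ∀ ε → 0# < ε → ∃[ δ ] (0# < δ ×
      (∀ h → ∥ h ∥ < δ → ∥ f (s +ᶜ h) -ᶜ f s -ᶜ d *ᶜ h ∥ ≤ ε * ∥ h ∥))

  Differentiable : (ℂ → ℂ) → ℂ → Set
  Differentiable f s = ∃ (HasDerivative f s)

  -- f vanishes at ρ to order exactly m: near ρ, f(s) = (s - ρ)^m g(s) with
  -- g holomorphic and g(ρ) ≠ 0.
  HasOrder : (ℂ → ℂ) → ℂ → ℕ → Set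
  HasOrder f ρ m =
    Σ (ℂ → ℂ) λ g → ∃[ r ] (0# < r × g ρ ≢ 0ᶜ ×
      (∀ s → ∥ s -ᶜ ρ ∥ < r →
         Differentiable g s × f s ≡ (s -ᶜ ρ) ^ᶜ m *ᶜ g s))

  ----------------------------------------------------------------------
  -- Exponential, logarithm and powers

  exp : ℂ → ℂ
  exp z = lim (λ n → sum< n (λ k → ofℝ (fromℕ (k !) ⁻¹) *ᶜ z ^ᶜ k))

  expʳ : ℝ → ℝ
  expʳ x = re (exp (ofℝ x))

  -- Meaningful for positive arguments only, as are the powers below.
  log : ℝ → ℝ
  log x = sup (λ t → expʳ t ≤ x)

  infixr 8 _^ʳ_
  _^ʳ_ : ℝ → ℝ → ℝ
  x ^ʳ t = expʳ (t * log x)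

  _^-_ : ℕ → ℂ → ℂ
  m ^- s = exp (-ᶜ (s *ᶜ ofℝ (log (fromℕ m))))

  ----------------------------------------------------------------------
  -- Dirichlet polynomials

  infix 4 _∼_
  _∼_ : ℕ → ℝ → Set
  m ∼ M = M ≤ fromℕ m × fromℕ m < 2# * M

  -- Natural numbers suffice as indices, because m ∼ M forces 0 < M.  The
  -- value does not depend on the chosen cut-off ≥ 2M, which exists because
  -- a complete ordered field is Archimedean.
  dirichletPoly : ℝ → (ℕ → ℝ) → ℂ → ℂ
  dirichletPoly M a s = sum< cutoff term
    where
    cutoff : ℕ
    cutoff = choose (λ n → 2# * M ≤ fromℕ n) 0

    term : ℕ → ℂ
    term m = if does (lem {m ∼ M}) then ofℝ (a m) *ᶜ m ^- s else 0ᶜ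

  ----------------------------------------------------------------------
  -- The Riemann zeta function and its zeros

  -- By uniqueness of analytic continuation this determines ζ everywhere
  -- except at the pole s = 1, where its value is irrelevant.
  IsRiemannZeta : (ℂ → ℂ) → Set
  IsRiemannZeta ζ =
    (∀ s → 1# < re s → (λ n → sum< n (λ k → suc k ^- s)) ⟶ ζ s) ×
    (∀ s → s ≢ 1ᶜ → Differentiable ζ s)

  -- The non-trivial zeros are those in the critical strip.
  IsNontrivialZero : (ℂ → ℂ) → ℂ → Set
  IsNontrivialZero ζ ρ = ζ ρ ≡ 0ᶜ × 0# < re ρ × re ρ < 1#

  -- A zero ρ of order m is represented by the m pairs (ρ , 0) , … ,
  -- (ρ , m - 1), so that sums over such pairs count multiplicity.
  IsCountedZero : (ℂ → ℂ) → ℂ × ℕ → Set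
  IsCountedZero ζ (ρ , j) =
    IsNontrivialZero ζ ρ × (∃[ m ] (HasOrder ζ ρ m × j ℕ.< m))

  ----------------------------------------------------------------------
  -- Sums of nonnegative functions

  IsFiniteSubsum : {A : Set} → (A → Set) → (A → ℝ) → ℝ → Set
  IsFiniteSubsum {A} S f t =
    Σ (List A) λ l → Unique l × All S l × t ≡ foldr _+_ 0# (map f l)

  -- v is the sum over the set S of the nonnegative function f.
  IsSum : {A : Set} → (A → Set) → (A → ℝ) → ℝ → Set
  IsSum S f = IsLub (IsFiniteSubsum S f)

  -- The sum of f(ρ), f ≥ 0, over the non-trivial zeros ρ satisfying P, with
  -- multiplicity, is finite and at most B.
  ZeroSumAtMost : (ℂ → ℂ) → (ℂ → Set) → (ℂ → ℝ) → ℝ → Set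
  ZeroSumAtMost ζ P f B =
    ∃[ v ] (IsSum (λ z → IsCountedZero ζ z × P (proj₁ z)) (λ z → f (proj₁ z)) v
            × v ≤ B)

{-# OPTIONS --safe #-}
module Submission where

-- Put L = log x and cut 0 < β ≤ 1 into K layers of width 1 / K, where
-- L ≤ K ≤ 2 L.  On the layer k / K ≤ β ≤ (k + 1) / K the weight x ^ (β - 1) is
-- at most x ^ ((k + 1) / K - 1), so by the hypothesis with σ = k / K the layer
-- contributes at most C * x ^ (1 / K) * L ^ c ≤ C * e * L ^ c; summing over the
-- layers costs the extra factor log x.
--
-- The functional equation of exp comes from the Cauchy product: for the terms a, b
-- of the series of exp x and exp y, the remainder
-- S n a * S n b - S n (a ⋆ b) is dominated by the one for ∣ x ∣ and ∣ y ∣, which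
-- tends to 0 because for nonnegative terms S n a * S n b ≤ S (n + n) (a ⋆ b).

open import Defs
open import Level using (0ℓ)
open import Algebra.Bundles using (CommutativeRing)
open import Algebra.Bundles.Raw using (RawRing)
import Algebra.Definitions.RawSemiring as RawSemiringDefs
import Algebra.Properties.Ring as RingProperties
import Algebra.Properties.Semiring.Mult as SemiringMult
import Algebra.Properties.Semiring.Mult.TCOptimised as SemiringMultTCO
import Algebra.Solver.Ring
open import Algebra.Solver.Ring.AlmostCommutativeRing
  using (_-Raw-AlmostCommutative⟶_; fromCommutativeRing)
open import Axiom.ExcludedMiddle using (ExcludedMiddle)
open import Data.Integer.Base as ℤ using (ℤ; +_; -[1+_]; _⊖_)
import Data.Integer.Properties as ℤ
open import Data.List.Base using (List; []; _∷_; map; foldr; filter)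
open import Data.List.Relation.Unary.All as All using (All) renaming ([] to []ᵃ; _∷_ to _∷ᵃ_)
open import Data.List.Relation.Unary.All.Properties using (all-filter) renaming (filter⁺ to filterᵃ⁺)
open import Data.List.Relation.Unary.AllPairs using () renaming ([] to []ᵘ)
open import Data.List.Relation.Unary.Unique.Propositional using (Unique)
open import Data.List.Relation.Unary.Unique.Propositional.Properties using () renaming (filter⁺ to filterᵘ⁺)
open import Data.Maybe.Base using (Maybe; just; nothing)
open import Data.Nat.Base as ℕ using (ℕ; zero; suc; _!)
import Data.Nat.Properties as ℕ
open import Data.Product.Base using (∃; ∃-syntax; _×_; _,_; proj₁; proj₂)
open import Data.Sum.Base using (inj₁; inj₂)
open import Relation.Binary.Bundles using (Poset)
open import Relation.Binary.PropositionalEquality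
  using (_≡_; _≢_; refl; sym; trans; cong; cong₂; subst; subst₂; module ≡-Reasoning)
open import Relation.Binary.Structures using (IsTotalOrder)
open import Relation.Unary using (Decidable)
open import Relation.Unary.Properties using (∁?)
open import Relation.Nullary using (¬_; yes; no; contradiction)

-- The sums over zeros are suprema of finite subsums, so the layer argument runs on an arbitrary
-- finite list of zeros with a bound independent of the list; completeness then supplies the sum.
-- Layers stand in for the integral over σ of a partial summation: finitely many instances of the
-- hypothesis suffice, because a list inside a layer is in particular a list inside the tail
-- `σ ≤ β`.
--
-- By definition `x ^ʳ t` is `expʳ (t * log x)`, so powers of x are exponentials with L as a
-- parameter, and the law `expʳ-+` makes them cancel. Since `exp` is a chosen limit of partial sums
-- and `log` a supremum, this law, positivity and monotonicity must all be extracted from the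
-- series, which accounts for most of the length.

module IntegerCoefficientSolver (A : CommutativeRing 0ℓ 0ℓ) where
  open CommutativeRing A hiding (sym; trans; refl)
  open CommutativeRing A using () renaming (sym to ≈-sym; trans to ≈-trans; refl to ≈-refl)
  open RingProperties ring
  open SemiringMultTCO semiring renaming (_×_ to _×′_)
  open import Relation.Binary.Reasoning.Setoid setoid

  -- With the optimised multiple `_×′_`, the constants `con (+ 1)` and `con (+ 2)` compute to `1#`
  -- and `1# + 1#`, so solved identities match the goals without further rewriting. Decidable
  -- equality of integer coefficients is what lets terms cancel.
  fromℤ : ℤ → Carrier
  fromℤ (+ n)    = n ×′ 1#
  fromℤ -[1+ n ] = - (suc n ×′ 1#)

  fromℤ-neg : ∀ i → fromℤ (ℤ.- i) ≈ - fromℤ i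
  fromℤ-neg (+ zero)  = ≈-sym -0#≈0#
  fromℤ-neg (+ suc n) = ≈-refl
  fromℤ-neg -[1+ n ]  = ≈-sym (-‿involutive _)

  1+×′ : ∀ n → suc n ×′ 1# ≈ 1# + n ×′ 1#
  1+×′ n = ×-homo-+ 1# 1 n

  fromℤ-⊖ : ∀ m n → fromℤ (m ⊖ n) ≈ m ×′ 1# - n ×′ 1#
  fromℤ-⊖ m zero = begin
    m ×′ 1#      ≈⟨ +-identityʳ _ ⟨
    m ×′ 1# + 0# ≈⟨ +-congˡ -0#≈0# ⟨
    m ×′ 1# - 0# ∎
  fromℤ-⊖ zero (suc n) = ≈-sym (+-identityˡ _)
  fromℤ-⊖ (suc m) (suc n) = begin
    fromℤ (suc m ⊖ suc n)                      ≡⟨ cong fromℤ (ℤ.[1+m]⊖[1+n]≡m⊖n m n) ⟩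
    fromℤ (m ⊖ n)                              ≈⟨ fromℤ-⊖ m n ⟩
    m ×′ 1# - n ×′ 1#                          ≈⟨ +-congʳ (+-identityʳ _) ⟨
    m ×′ 1# + 0# - n ×′ 1#                     ≈⟨ +-congʳ (+-congˡ (-‿inverseʳ 1#)) ⟨
    m ×′ 1# + (1# - 1#) - n ×′ 1#              ≈⟨ +-congʳ (+-assoc _ _ _) ⟨
    m ×′ 1# + 1# - 1# - n ×′ 1#                ≈⟨ +-assoc _ _ _ ⟩
    m ×′ 1# + 1# + (- 1# - n ×′ 1#)            ≈⟨ +-cong (+-comm _ _) (-‿+-comm _ _) ⟩
    1# + m ×′ 1# - (1# + n ×′ 1#)              ≈⟨ +-cong (1+×′ m) (-‿cong (1+×′ n)) ⟨
    suc m ×′ 1# - suc n ×′ 1#                  ∎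

  fromℤ-+ : ∀ i j → fromℤ (i ℤ.+ j) ≈ fromℤ i + fromℤ j
  fromℤ-+ (+ m)    (+ n)    = ×-homo-+ 1# m n
  fromℤ-+ (+ m)    -[1+ n ] = fromℤ-⊖ m (suc n)
  fromℤ-+ -[1+ m ] (+ n)    = ≈-trans (fromℤ-⊖ n (suc m)) (+-comm _ _)
  fromℤ-+ -[1+ m ] -[1+ n ] = begin
    - (suc (suc (m ℕ.+ n)) ×′ 1#)          ≡⟨ cong (λ k → - (suc k ×′ 1#)) (ℕ.+-suc m n) ⟨
    - ((suc m ℕ.+ suc n) ×′ 1#)            ≈⟨ -‿cong (×-homo-+ 1# (suc m) (suc n)) ⟩
    - (suc m ×′ 1# + suc n ×′ 1#)          ≈⟨ -‿+-comm _ _ ⟨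
    - (suc m ×′ 1#) - suc n ×′ 1#          ∎

  fromℤ-+* : ∀ m j → fromℤ (+ m ℤ.* j) ≈ fromℤ (+ m) * fromℤ j
  fromℤ-+* m (+ n) = begin
    fromℤ (+ m ℤ.* + n)      ≡⟨ cong fromℤ (ℤ.pos-* m n) ⟨
    (m ℕ.* n) ×′ 1#          ≈⟨ ×1-homo-* m n ⟩
    m ×′ 1# * n ×′ 1#        ∎
  fromℤ-+* m -[1+ n ] = begin
    fromℤ (+ m ℤ.* -[1+ n ])        ≡⟨ cong fromℤ (ℤ.neg-distribʳ-* (+ m) (+ suc n)) ⟨
    fromℤ (ℤ.- (+ m ℤ.* + suc n))   ≈⟨ fromℤ-neg (+ m ℤ.* + suc n) ⟩
    - fromℤ (+ m ℤ.* + suc n)       ≈⟨ -‿cong (fromℤ-+* m (+ suc n)) ⟩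
    - (m ×′ 1# * suc n ×′ 1#)       ≈⟨ -‿distribʳ-* _ _ ⟩
    m ×′ 1# * - (suc n ×′ 1#)       ∎

  fromℤ-* : ∀ i j → fromℤ (i ℤ.* j) ≈ fromℤ i * fromℤ j
  fromℤ-* (+ m)    j = fromℤ-+* m j
  fromℤ-* -[1+ m ] j = begin
    fromℤ (-[1+ m ] ℤ.* j)        ≡⟨ cong fromℤ (ℤ.neg-distribˡ-* (+ suc m) j) ⟨
    fromℤ (ℤ.- (+ suc m ℤ.* j))   ≈⟨ fromℤ-neg (+ suc m ℤ.* j) ⟩
    - fromℤ (+ suc m ℤ.* j)       ≈⟨ -‿cong (fromℤ-+* (suc m) j) ⟩
    - (suc m ×′ 1# * fromℤ j)     ≈⟨ -‿distribˡ-* _ _ ⟩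
    - (suc m ×′ 1#) * fromℤ j     ∎

  homomorphism : ℤ.+-*-rawRing -Raw-AlmostCommutative⟶ fromCommutativeRing A
  homomorphism = record
    { ⟦_⟧    = fromℤ
    ; +-homo = fromℤ-+
    ; *-homo = fromℤ-*
    ; -‿homo = fromℤ-neg
    ; 0-homo = ≈-refl
    ; 1-homo = ≈-refl
    }

  coefficient≟ : ∀ i j → Maybe (fromℤ i ≈ fromℤ j)
  coefficient≟ i j with i ℤ.≟ j
  ... | yes refl = just ≈-refl
  ... | no  _    = nothing

  open Algebra.Solver.Ring ℤ.+-*-rawRing (fromCommutativeRing A) homomorphism coefficient≟ public
    using (solve; _:=_; con; _:+_; _:*_; _:-_; :-_)

-- Arithmetic in an ordered field.

module OrderedField (lem : ExcludedMiddle 0ℓ) (R : CompleteOrderedField) where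
  open CompleteOrderedField R

  commutativeRing : CommutativeRing 0ℓ 0ℓ
  commutativeRing = record { isCommutativeRing = isCommutativeRing }

  open CommutativeRing commutativeRing public
    using (+-identityˡ; +-identityʳ; *-identityˡ; *-identityʳ; zeroˡ; zeroʳ;
           +-comm; +-assoc; *-comm; *-assoc; semiring)
  open IntegerCoefficientSolver commutativeRing public
    using (solve; _:=_; con; _:+_; _:*_; _:-_; :-_)
  open IsTotalOrder isTotalOrder public
    using ()
    renaming (refl to ≤-refl; trans to ≤-trans; reflexive to ≤-reflexive;
              antisym to ≤-antisym; total to ≤-total; isPartialOrder to ≤-isPartialOrder)

  ≤-poset : Poset 0ℓ 0ℓ 0ℓ
  ≤-poset = record { isPartialOrder = ≤-isPartialOrder }

  module ≤-Reasoning where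
    open import Relation.Binary.Reasoning.PartialOrder ≤-poset public
      using (begin_; _∎; step-≤; step-≡-⟩; step-≡-⟨)

  ≤⇒0≤- : ∀ {x y} → x ≤ y → 0# ≤ y - x
  ≤⇒0≤- {x} {y} x≤y = subst (_≤ y - x)
    (solve 1 (λ x → x :- x := con (+ 0)) refl x) (+-monoˡ-≤ (- x) x≤y)

  -- Inequalities are proved by exhibiting y - x as a manifestly nonnegative d.
  ≤-by : ∀ {x y} d → 0# ≤ d → y - x ≡ d → x ≤ y
  ≤-by {x} {y} d 0≤d eq = subst₂ _≤_
    (+-identityˡ x)
    (trans (cong (_+ x) (sym eq)) (solve 2 (λ x y → y :- x :+ x := y) refl x y))
    (+-monoˡ-≤ x 0≤d)

  +-mono-≤ : ∀ {x y u v} → x ≤ y → u ≤ v → x + u ≤ y + v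
  +-mono-≤ {x} {y} {u} {v} x≤y u≤v = ≤-trans (+-monoˡ-≤ u x≤y)
    (subst₂ _≤_ (+-comm u y) (+-comm v y) (+-monoˡ-≤ y u≤v))

  +-nonneg : ∀ {x y} → 0# ≤ x → 0# ≤ y → 0# ≤ x + y
  +-nonneg {x} {y} p q = subst (_≤ x + y) (+-identityˡ 0#) (+-mono-≤ p q)

  +-monoʳ-≤ : ∀ z {x y} → x ≤ y → z + x ≤ z + y
  +-monoʳ-≤ z p = +-mono-≤ (≤-refl {z}) p

  *-monoˡ-≤ : ∀ {z} → 0# ≤ z → ∀ {x y} → x ≤ y → z * x ≤ z * y
  *-monoˡ-≤ {z} 0≤z {x} {y} p = ≤-by (z * (y - x)) (*-nonneg 0≤z (≤⇒0≤- p))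
    (solve 3 (λ x y z → z :* y :- z :* x := z :* (y :- x)) refl x y z)

  *-monoʳ-≤ : ∀ {z} → 0# ≤ z → ∀ {x y} → x ≤ y → x * z ≤ y * z
  *-monoʳ-≤ {z} 0≤z {x} {y} p = subst₂ _≤_ (*-comm z x) (*-comm z y) (*-monoˡ-≤ 0≤z p)

  0≤x*x : ∀ x → 0# ≤ x * x
  0≤x*x x with ≤-total 0# x
  ... | inj₁ 0≤x = *-nonneg 0≤x 0≤x
  ... | inj₂ x≤0 = subst (0# ≤_) (solve 1 (λ x → (con (+ 0) :- x) :* (con (+ 0) :- x) := x :* x) refl x)
    (*-nonneg (≤⇒0≤- x≤0) (≤⇒0≤- x≤0))

  0≤1 : 0# ≤ 1#
  0≤1 = subst (0# ≤_) (*-identityˡ 1#) (0≤x*x 1#)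

  0<1 : 0# < 1#
  0<1 = 0≤1 , 0≢1

  <-≤-trans : ∀ {x y z} → x < y → y ≤ z → x < z
  <-≤-trans (x≤y , x≢y) y≤z = ≤-trans x≤y y≤z , λ { refl → x≢y (≤-antisym x≤y y≤z) }

  ≤-<-trans : ∀ {x y z} → x ≤ y → y < z → x < z
  ≤-<-trans x≤y (y≤z , y≢z) = ≤-trans x≤y y≤z , λ { refl → y≢z (≤-antisym y≤z x≤y) }

  <⇒≱ : ∀ {x y} → x < y → ¬ y ≤ x
  <⇒≱ (x≤y , x≢y) y≤x = x≢y (≤-antisym x≤y y≤x)

  0<⇒≢0 : ∀ {x} → 0# < x → x ≢ 0#
  0<⇒≢0 (_ , 0≢x) refl = 0≢x refl

  *-inverseˡ : ∀ {x} → x ≢ 0# → x ⁻¹ * x ≡ 1#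
  *-inverseˡ {x} x≢0 = trans (*-comm (x ⁻¹) x) (⁻¹-inverseʳ x x≢0)

  *-cancelˡ : ∀ {a} → a ≢ 0# → ∀ {x y} → a * x ≡ a * y → x ≡ y
  *-cancelˡ {a} a≢0 {x} {y} eq = begin
    x                ≡⟨ cancel x ⟨
    a ⁻¹ * (a * x)   ≡⟨ cong (a ⁻¹ *_) eq ⟩
    a ⁻¹ * (a * y)   ≡⟨ cancel y ⟩
    y                ∎
    where
    open ≡-Reasoning
    cancel : ∀ z → a ⁻¹ * (a * z) ≡ z
    cancel z = trans (sym (*-assoc (a ⁻¹) a z)) (trans (cong (_* z) (*-inverseˡ a≢0)) (*-identityˡ z))

  *-≢0 : ∀ {a b} → a ≢ 0# → b ≢ 0# → a * b ≢ 0#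
  *-≢0 {a} a≢0 b≢0 eq = b≢0 (*-cancelˡ a≢0 (trans eq (sym (zeroʳ a))))

  *-pos : ∀ {a b} → 0# < a → 0# < b → 0# < a * b
  *-pos 0<a 0<b = *-nonneg (proj₁ 0<a) (proj₁ 0<b) ,
    λ eq → *-≢0 (0<⇒≢0 0<a) (0<⇒≢0 0<b) (sym eq)

  *-cancelˡ-≤ : ∀ {a} → 0# < a → ∀ {x y} → a * x ≤ a * y → x ≤ y
  *-cancelˡ-≤ {a} 0<a {x} {y} p with ≤-total x y
  ... | inj₁ x≤y = x≤y
  ... | inj₂ y≤x = ≤-reflexive
    (*-cancelˡ (0<⇒≢0 0<a) (≤-antisym p (*-monoˡ-≤ (proj₁ 0<a) y≤x)))

  ⁻¹-pos : ∀ {a} → 0# < a → 0# < a ⁻¹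
  ⁻¹-pos {a} 0<a = *-cancelˡ-≤ 0<a (subst₂ _≤_ (sym (zeroʳ a)) (sym inv) 0≤1)
    , λ eq → 0≢1 (trans (sym (zeroʳ a)) (trans (cong (a *_) eq) inv))
    where
    inv : a * a ⁻¹ ≡ 1#
    inv = ⁻¹-inverseʳ a (0<⇒≢0 0<a)

  +-pos : ∀ {x y} → 0# < x → 0# ≤ y → 0# < x + y
  +-pos {x} {y} 0<x 0≤y = <-≤-trans 0<x (subst (_≤ x + y) (+-identityʳ x) (+-monoʳ-≤ x 0≤y))

  two : CompleteOrderedField.ℝ R
  two = 1# + 1#

  0<2 : 0# < two
  0<2 = +-pos 0<1 0≤1

  half : ∀ x → two ⁻¹ * x + two ⁻¹ * x ≡ x
  half x = begin
    two ⁻¹ * x + two ⁻¹ * x  ≡⟨ solve 2 (λ h x → h :* x :+ h :* x := h :* con (+ 2) :* x) refl (two ⁻¹) x ⟩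
    two ⁻¹ * two * x         ≡⟨ cong (_* x) (*-inverseˡ (0<⇒≢0 0<2)) ⟩
    1# * x                   ≡⟨ *-identityˡ x ⟩
    x                        ∎
    where open ≡-Reasoning

  half-pos : ∀ {x} → 0# < x → 0# < two ⁻¹ * x
  half-pos = *-pos (⁻¹-pos 0<2)

  ≰⇒> : ∀ {x y} → ¬ x ≤ y → y < x
  ≰⇒> {x} {y} x≰y with ≤-total x y
  ... | inj₁ x≤y = contradiction x≤y x≰y
  ... | inj₂ y≤x = y≤x , λ { refl → x≰y y≤x }

  <⇒0<- : ∀ {x y} → x < y → 0# < y - x
  <⇒0<- {x} {y} (x≤y , x≢y) = ≤⇒0≤- x≤y , λ eq → x≢y (begin
    x            ≡⟨ +-identityˡ x ⟨
    0# + x       ≡⟨ cong (_+ x) eq ⟩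
    y - x + x    ≡⟨ solve 2 (λ x y → y :- x :+ x := y) refl x y ⟩
    y            ∎)
    where open ≡-Reasoning

  ≤-stable : ∀ {x y} → ¬ (y < x) → x ≤ y
  ≤-stable {x} {y} ¬y<x with lem {x ≤ y}
  ... | yes x≤y = x≤y
  ... | no  x≰y = contradiction (≰⇒> x≰y) ¬y<x

  ≤-from-ε : ∀ {x y} → (∀ ε → 0# < ε → x ≤ y + ε) → x ≤ y
  ≤-from-ε {x} {y} p = ≤-stable λ y<x →
    -- For this ε the slack `y + ε - x` is exactly `- ε`, which cannot be nonnegative.
    let ε = two ⁻¹ * (x - y)
        0<ε = half-pos (<⇒0<- y<x)
    in <⇒≱ 0<ε (≤-by (y + ε - x) (≤⇒0≤- (p ε 0<ε)) (begin
         0# - ε                 ≡⟨ solve 3 (λ x y e → con (+ 0) :- e := y :+ e :- x :+ (x :- y :- (e :+ e))) refl x y ε ⟩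
         y + ε - x + (x - y - (ε + ε))    ≡⟨ cong (λ d → y + ε - x + (x - y - d)) (half (x - y)) ⟩
         y + ε - x + (x - y - (x - y))    ≡⟨ solve 3 (λ x y z → z :+ (x :- y :- (x :- y)) := z) refl x y (y + ε - x) ⟩
         y + ε - x              ∎))
    where open ≡-Reasoning

  half-< : ∀ {x} → 0# < x → two ⁻¹ * x < x
  half-< {x} 0<x = subst (two ⁻¹ * x <_) (half x)
    (≤-by h (proj₁ 0<h) (solve 1 (λ h → h :+ h :- h := h) refl h)
    , λ eq → proj₂ 0<h (trans (solve 1 (λ h → con (+ 0) := h :- h) refl h)
        (trans (cong (_- h) eq) (solve 1 (λ h → h :+ h :- h := h) refl h))))
    where
    h = two ⁻¹ * x
    0<h = half-pos 0<x

  -- If `y < x`, then `x - y` is positive and so is `x + y`, which is at least as large; their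
  -- product `x * x - y * y` would be positive. No sign of `x` is assumed.
  square-cancel-≤ : ∀ {x y} → 0# ≤ y → x * x ≤ y * y → x ≤ y
  square-cancel-≤ {x} {y} 0≤y p = ≤-stable λ y<x →
    <⇒≱ (*-pos (<⇒0<- y<x) (<-≤-trans (<⇒0<- y<x) (≤-by (y + y) (+-nonneg 0≤y 0≤y)
          (solve 2 (λ x y → x :+ y :- (x :- y) := y :+ y) refl x y))))
      (≤-by (y * y - x * x) (≤⇒0≤- p)
        (solve 2 (λ x y → con (+ 0) :- (x :- y) :* (x :+ y) := y :* y :- x :* x) refl x y))

  halve-nonneg : ∀ {x} → 0# ≤ x + x → 0# ≤ x
  halve-nonneg {x} p = subst (0# ≤_)
    (trans (solve 2 (λ h x → h :* (x :+ x) := h :* x :+ h :* x) refl (two ⁻¹) x) (half x))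
    (*-nonneg (proj₁ (⁻¹-pos 0<2)) p)

  -- This is ∣ x ∣ ≤ X, kept as two inequalities between polynomials: estimates with absolute values
  -- then reduce to ring identities, and no case distinction on signs is carried along.
  record Dominates (X x : CompleteOrderedField.ℝ R) : Set where
    constructor dominates
    field
      lower : 0# ≤ X + x
      upper : 0# ≤ X - x

  -- Twice `X * Y + x * y` is (X + x)(Y + y) + (X - x)(Y - y), and twice `X * Y - x * y` is the sum
  -- of the two mixed products; all factors are nonnegative.
  Dominates-* : ∀ {X x Y y} → Dominates X x → Dominates Y y → Dominates (X * Y) (x * y)
  Dominates-* {X} {x} {Y} {y} (dominates lx ux) (dominates ly uy) = dominates
    (halve-nonneg (subst (0# ≤_)
      (solve 4 (λ X x Y y → (X :+ x) :* (Y :+ y) :+ (X :- x) :* (Y :- y)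
                  := (X :* Y :+ x :* y) :+ (X :* Y :+ x :* y)) refl X x Y y)
      (+-nonneg (*-nonneg lx ly) (*-nonneg ux uy))))
    (halve-nonneg (subst (0# ≤_)
      (solve 4 (λ X x Y y → (X :- x) :* (Y :+ y) :+ (X :+ x) :* (Y :- y)
                  := (X :* Y :- x :* y) :+ (X :* Y :- x :* y)) refl X x Y y)
      (+-nonneg (*-nonneg ux ly) (*-nonneg lx uy))))

  Dominates-+ : ∀ {X x Y y} → Dominates X x → Dominates Y y → Dominates (X + Y) (x + y)
  Dominates-+ {X} {x} {Y} {y} (dominates lx ux) (dominates ly uy) = dominates
    (subst (0# ≤_) (solve 4 (λ X x Y y → X :+ x :+ (Y :+ y) := X :+ Y :+ (x :+ y)) refl X x Y y) (+-nonneg lx ly))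
    (subst (0# ≤_) (solve 4 (λ X x Y y → X :- x :+ (Y :- y) := X :+ Y :- (x :+ y)) refl X x Y y) (+-nonneg ux uy))

  Dominates-neg : ∀ {X x} → Dominates X x → Dominates X (- x)
  Dominates-neg {X} {x} (dominates l u) = dominates u
    (subst (0# ≤_) (solve 2 (λ X x → X :+ x := X :- :- x) refl X x) l)

  Dominates-≤ : ∀ {X Y x} → X ≤ Y → Dominates X x → Dominates Y x
  Dominates-≤ {x = x} X≤Y (dominates l u) = dominates (≤-trans l (+-monoˡ-≤ x X≤Y)) (≤-trans u (+-monoˡ-≤ (- x) X≤Y))

  dominates-self : ∀ {x} → 0# ≤ x → Dominates x x
  dominates-self {x} 0≤x = dominates (+-nonneg 0≤x 0≤x)
    (subst (0# ≤_) (solve 1 (λ x → con (+ 0) := x :- x) refl x) ≤-refl)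

  dominates-intro : ∀ {X x} → - x ≤ X → x ≤ X → Dominates X x
  dominates-intro {X} {x} -x≤X x≤X = dominates
    (subst (0# ≤_) (solve 2 (λ X x → X :- :- x := X :+ x) refl X x) (≤⇒0≤- -x≤X))
    (≤⇒0≤- x≤X)

  -- Here ∣ a - b ∣ ≤ A - B ≤ 0. This turns a mere inequality between the dominating quantities into
  -- an equality between the dominated ones.
  dominated-difference : ∀ {A B a b} → Dominates (A - B) (a - b) → A ≤ B → a ≡ b
  dominated-difference {A} {B} {a} {b} (dominates l u) A≤B = ≤-antisym
    (≤-by (A - B - (a - b) + (B - A)) (+-nonneg u (≤⇒0≤- A≤B))
      (solve 4 (λ A B a b → b :- a := A :- B :- (a :- b) :+ (B :- A)) refl A B a b))
    (≤-by (A - B + (a - b) + (B - A)) (+-nonneg l (≤⇒0≤- A≤B))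
      (solve 4 (λ A B a b → a :- b := A :- B :+ (a :- b) :+ (B :- A)) refl A B a b))

  dominated : ∀ x → ∃[ X ] (0# ≤ X × Dominates X x)
  dominated x with ≤-total 0# x
  ... | inj₁ 0≤x = x , 0≤x , dominates-self 0≤x
  ... | inj₂ x≤0 = - x , 0≤-x , dominates
          (subst (0# ≤_) (solve 1 (λ x → con (+ 0) := :- x :+ x) refl x) ≤-refl)
          (+-nonneg 0≤-x 0≤-x)
    where
    0≤-x : 0# ≤ - x
    0≤-x = subst (0# ≤_) (+-identityˡ (- x)) (≤⇒0≤- x≤0)

module RealAnalysis (lem : ExcludedMiddle 0ℓ) (R : CompleteOrderedField) where
  open Analysis lem R
  open OrderedField lem R
  open SemiringMult semiring using (×1-homo-*)
  open RawSemiringDefs (RawRing.rawSemiring ℝ-rawRing) using (_^_)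

  -- Natural numbers in the field and the Archimedean property.

  fromℕ-nonneg : ∀ n → 0# ≤ fromℕ n
  fromℕ-nonneg zero    = ≤-refl
  fromℕ-nonneg (suc n) = +-nonneg 0≤1 (fromℕ-nonneg n)

  fromℕ-suc-pos : ∀ n → 0# < fromℕ (suc n)
  fromℕ-suc-pos n = +-pos 0<1 (fromℕ-nonneg n)

  fromℕ-mono : ∀ {m n} → m ℕ.≤ n → fromℕ m ≤ fromℕ n
  fromℕ-mono {n = n} ℕ.z≤n = fromℕ-nonneg n
  fromℕ-mono (ℕ.s≤s m≤n) = +-monoʳ-≤ 1# (fromℕ-mono m≤n)

  -- Otherwise the natural numbers have a supremum `s`; as `suc n` is bounded by `s` for every `n`,
  -- already `s - 1#` is an upper bound.
  archimedean : ∀ x → ∃[ n ] x ≤ fromℕ n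
  archimedean x with lem {∃[ n ] x ≤ fromℕ n}
  ... | yes p = p
  ... | no ¬p = contradiction (least (s - 1#) below) (<⇒≱ s-1<s)
    where
    P : ℝ → Set
    P t = ∃[ n ] t ≡ fromℕ n
    lub : ∃ (IsLub P)
    lub = complete P (0# , 0 , refl) (x , λ { t (n , refl) → proj₁ (≰⇒> (λ q → ¬p (n , q))) })
    s = proj₁ lub
    upper = proj₁ (proj₂ lub)
    least = proj₂ (proj₂ lub)
    below : IsUpperBound P (s - 1#)
    below t (n , refl) = ≤-by (s - fromℕ (suc n)) (≤⇒0≤- (upper _ (suc n , refl)))
      (solve 2 (λ s k → s :- con (+ 1) :- k := s :- (con (+ 1) :+ k)) refl s (fromℕ n))
    s-1<s : s - 1# < s
    s-1<s = ≤-by 1# 0≤1 (solve 1 (λ s → s :- (s :- con (+ 1)) := con (+ 1)) refl s)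
      , λ eq → 0≢1 (trans (solve 1 (λ s → con (+ 0) := s :- s) refl s)
          (trans (cong (λ t → s - t) (sym eq)) (solve 1 (λ s → s :- (s :- con (+ 1)) := con (+ 1)) refl s)))

  -- The search descends from an Archimedean bound and stops at the first `suc n` with
  -- `fromℕ n ≤ x`. Applied to L, it yields the number of layers.
  ceiling : ∀ x → 0# ≤ x → ∃[ n ] (x ≤ fromℕ n × fromℕ n ≤ x + 1#)
  ceiling x 0≤x = descend (proj₁ (archimedean x)) (proj₂ (archimedean x))
    where
    descend : ∀ n → x ≤ fromℕ n → ∃[ n ] (x ≤ fromℕ n × fromℕ n ≤ x + 1#)
    descend zero    x≤0 = zero , x≤0 , +-nonneg 0≤x 0≤1
    descend (suc n) x≤n with ≤-total x (fromℕ n)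
    ... | inj₁ x≤n′ = descend n x≤n′
    ... | inj₂ n≤x  = suc n , x≤n , subst (_≤ x + 1#) (+-comm (fromℕ n) 1#) (+-monoˡ-≤ 1# n≤x)

  -- Partial sums and the Cauchy product

  S : ℕ → (ℕ → ℝ) → ℝ
  S zero    a = 0#
  S (suc n) a = S n a + a n

  shift : (ℕ → ℝ) → ℕ → ℝ
  shift a n = a (suc n)

  -- The Cauchy product, ∑ a i * b j over i + j = n. Peeling off `a 0` avoids subtraction of indices
  -- and suits inductions that replace `a` by `shift a`.
  infixl 7 _⋆_
  _⋆_ : (ℕ → ℝ) → (ℕ → ℝ) → ℕ → ℝ
  (a ⋆ b) zero    = a 0 * b 0
  (a ⋆ b) (suc n) = a 0 * b (suc n) + (shift a ⋆ b) n

  S-cong : ∀ n {a b} → (∀ k → a k ≡ b k) → S n a ≡ S n b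
  S-cong zero    eq = refl
  S-cong (suc n) eq = cong₂ _+_ (S-cong n eq) (eq n)

  S-shift : ∀ n a → S (suc n) a ≡ a 0 + S n (shift a)
  S-shift zero    a = solve 1 (λ x → con (+ 0) :+ x := x :+ con (+ 0)) refl (a 0)
  S-shift (suc n) a = trans (cong (_+ a (suc n)) (S-shift n a)) (+-assoc _ _ _)

  S-⋆ : ∀ n a b → S (suc n) (a ⋆ b) ≡ a 0 * S (suc n) b + S n (shift a ⋆ b)
  S-⋆ zero    a b = solve 2 (λ x y → con (+ 0) :+ x :* y := x :* (con (+ 0) :+ y) :+ con (+ 0)) refl (a 0) (b 0)
  S-⋆ (suc n) a b = trans (cong (_+ (a ⋆ b) (suc n)) (S-⋆ n a b))
    (solve 5 (λ x s y t z → x :* s :+ t :+ (x :* y :+ z) := x :* (s :+ y) :+ (t :+ z)) refl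
      (a 0) (S (suc n) b) (b (suc n)) (S n (shift a ⋆ b)) ((shift a ⋆ b) n))

  -- The sequence `c` enters through its values only, so that no equality of functions is ever
  -- required.
  ⋆-linearˡ : ∀ {a a′ c} z b → (∀ k → c k ≡ z * a k + a′ k) →
    ∀ n → (c ⋆ b) n ≡ z * (a ⋆ b) n + (a′ ⋆ b) n
  ⋆-linearˡ {a} {a′} z b eq zero = trans (cong (_* b 0) (eq 0))
    (solve 4 (λ z x y w → (z :* x :+ y) :* w := z :* (x :* w) :+ y :* w) refl z (a 0) (a′ 0) (b 0))
  ⋆-linearˡ {a} {a′} z b eq (suc n) =
    trans (cong₂ (λ x y → x * b (suc n) + y) (eq 0) (⋆-linearˡ z b (λ k → eq (suc k)) n))
    (solve 6 (λ z x y w p q → (z :* x :+ y) :* w :+ (z :* p :+ q) := z :* (x :* w :+ p) :+ (y :* w :+ q)) refl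
      z (a 0) (a′ 0) (b (suc n)) ((shift a ⋆ b) n) ((shift a′ ⋆ b) n))

  ⋆-scaleˡ : ∀ {a c} z b → (∀ k → c k ≡ z * a k) → ∀ n → (c ⋆ b) n ≡ z * (a ⋆ b) n
  ⋆-scaleˡ {a} z b eq zero    = trans (cong (_* b 0) (eq 0)) (*-assoc z (a 0) (b 0))
  ⋆-scaleˡ {a} z b eq (suc n) =
    trans (cong₂ (λ x y → x * b (suc n) + y) (eq 0) (⋆-scaleˡ z b (λ k → eq (suc k)) n))
    (solve 4 (λ z x w p → z :* x :* w :+ z :* p := z :* (x :* w :+ p)) refl
      z (a 0) (b (suc n)) ((shift a ⋆ b) n))

  ⋆-scaleʳ : ∀ {b c} z a → (∀ k → c k ≡ z * b k) → ∀ n → (a ⋆ c) n ≡ z * (a ⋆ b) n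
  ⋆-scaleʳ {b} z a eq zero    = trans (cong (a 0 *_) (eq 0))
    (solve 3 (λ z x y → x :* (z :* y) := z :* (x :* y)) refl z (a 0) (b 0))
  ⋆-scaleʳ {b} z a eq (suc n) =
    trans (cong₂ (λ x y → a 0 * x + y) (eq (suc n)) (⋆-scaleʳ z (shift a) eq n))
    (solve 4 (λ z x w p → x :* (z :* w) :+ z :* p := z :* (x :* w :+ p)) refl
      z (a 0) (b (suc n)) ((shift a ⋆ b) n))

  -- The coefficients of the formal derivative of the power series with coefficients `a`.
  derivative : (ℕ → ℝ) → ℕ → ℝ
  derivative a n = fromℕ (suc n) * a (suc n)

  -- Write the factor `fromℕ (suc (suc n))` as 1 + f. On the part without `a 0`, the f copies fall
  -- to the induction hypothesis for `shift a`; the one remaining copy is absorbed because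
  -- `shift (derivative a)` is `derivative (shift a)` plus `shift (shift a)`.
  leibniz : ∀ a b n → derivative (a ⋆ b) n ≡ (derivative a ⋆ b) n + (a ⋆ derivative b) n
  leibniz a b zero =
    -- The literal `con (+ 1) :+ con (+ 0)` mirrors `fromℕ 1`, which unfolds to `1# + 0#`.
    solve 4 (λ a₀ a₁ b₀ b₁ → (con (+ 1) :+ con (+ 0)) :* (a₀ :* b₁ :+ a₁ :* b₀)
      := (con (+ 1) :+ con (+ 0)) :* a₁ :* b₀ :+ a₀ :* ((con (+ 1) :+ con (+ 0)) :* b₁)) refl
      (a 0) (a 1) (b 0) (b 1)
  leibniz a b (suc n) = begin
    (1# + f) * (a 0 * b₂ + (a 1 * b₁ + c))
      ≡⟨ solve 6 (λ f a₀ a₁ b₁ b₂ c → (con (+ 1) :+ f) :* (a₀ :* b₂ :+ (a₁ :* b₁ :+ c))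
           := f :* (a₁ :* b₁ :+ c) :+ ((con (+ 1) :+ con (+ 0)) :* a₁ :* b₁ :+ c :+ a₀ :* ((con (+ 1) :+ f) :* b₂))) refl
           f (a 0) (a 1) b₁ b₂ c ⟩
    f * (a 1 * b₁ + c) + ((1# + 0#) * a 1 * b₁ + c + a 0 * ((1# + f) * b₂))
      ≡⟨ cong (_+ ((1# + 0#) * a 1 * b₁ + c + a 0 * ((1# + f) * b₂))) (leibniz (shift a) b n) ⟩
    d + e + ((1# + 0#) * a 1 * b₁ + c + a 0 * ((1# + f) * b₂))
      ≡⟨ solve 5 (λ d e c p q → d :+ e :+ (p :+ c :+ q) := p :+ (con (+ 1) :* d :+ c) :+ (q :+ e)) refl
           d e c ((1# + 0#) * a 1 * b₁) (a 0 * ((1# + f) * b₂)) ⟩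
    (1# + 0#) * a 1 * b₁ + (1# * d + c) + (a 0 * ((1# + f) * b₂) + e)
      ≡⟨ cong (λ g → (1# + 0#) * a 1 * b₁ + g + (a 0 * ((1# + f) * b₂) + e))
           (⋆-linearˡ 1# b (λ k → solve 2 (λ m x → (con (+ 1) :+ m) :* x := con (+ 1) :* (m :* x) :+ x) refl
              (fromℕ (suc k)) (a (suc (suc k)))) n) ⟨
    (1# + 0#) * a 1 * b₁ + (shift (derivative a) ⋆ b) n + (a 0 * ((1# + f) * b₂) + e) ∎
    where
    open ≡-Reasoning
    f = fromℕ (suc n)
    b₁ = b (suc n)
    b₂ = b (suc (suc n))
    c = (shift (shift a) ⋆ b) n
    d = (derivative (shift a) ⋆ b) n
    e = (shift a ⋆ derivative b) n

  expTerm : ℝ → ℕ → ℝ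
  expTerm x k = fromℕ (k !) ⁻¹ * x ^ k

  fact-pos : ∀ k → 0# < fromℕ (k !)
  fact-pos k = <-≤-trans (fromℕ-suc-pos 0) (fromℕ-mono (ℕ.1≤n! k))

  -- The differential equation of t ↦ exp (x t), read off its coefficients. Multiplying by
  -- `fromℕ (k !)` removes both inverse factorials.
  derivative-expTerm : ∀ x k → derivative (expTerm x) k ≡ x * expTerm x k
  derivative-expTerm x k = *-cancelˡ (fact≢0 k) (begin
    g * (f * (fromℕ (suc k ℕ.* k !) ⁻¹ * (x * x ^ k)))
      ≡⟨ solve 4 (λ g f i p → g :* (f :* (i :* p)) := f :* g :* i :* p) refl g f (fromℕ (suc k ℕ.* k !) ⁻¹) (x * x ^ k) ⟩
    f * g * fromℕ (suc k ℕ.* k !) ⁻¹ * (x * x ^ k)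
      ≡⟨ cong (λ h → h * fromℕ (suc k ℕ.* k !) ⁻¹ * (x * x ^ k)) (×1-homo-* (suc k) (k !)) ⟨
    fromℕ (suc k ℕ.* k !) * fromℕ (suc k ℕ.* k !) ⁻¹ * (x * x ^ k)
      ≡⟨ cong (_* (x * x ^ k)) (⁻¹-inverseʳ _ (fact≢0 (suc k))) ⟩
    1# * (x * x ^ k)
      ≡⟨ cong (_* (x * x ^ k)) (⁻¹-inverseʳ g (fact≢0 k)) ⟨
    g * g ⁻¹ * (x * x ^ k)
      ≡⟨ solve 4 (λ g i x p → g :* i :* (x :* p) := g :* (x :* (i :* p))) refl g (g ⁻¹) x (x ^ k) ⟩
    g * (x * (g ⁻¹ * x ^ k)) ∎)
    where
    open ≡-Reasoning
    g = fromℕ (k !)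
    f = fromℕ (suc k)
    fact≢0 : ∀ k → fromℕ (k !) ≢ 0#
    fact≢0 k = 0<⇒≢0 (fact-pos k)

  expTerm-zero : ∀ x → expTerm x 0 ≡ 1#
  expTerm-zero x = trans (cong (_* x ^ 0) (trans (sym (*-identityˡ _)) (trans (cong (_* fromℕ 1 ⁻¹) (sym (+-identityʳ 1#)))
    (⁻¹-inverseʳ (fromℕ 1) (0<⇒≢0 (fromℕ-suc-pos 0)))))) (*-identityˡ 1#)

  -- By `leibniz` both sides obey the first-order recursion `derivative u n ≡ (x + y) * u n`, and
  -- both start at 1. This replaces the binomial theorem.
  expTerm-+ : ∀ x y n → (expTerm x ⋆ expTerm y) n ≡ expTerm (x + y) n
  expTerm-+ x y zero = trans (cong₂ _*_ (expTerm-zero x) (expTerm-zero y))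
    (trans (*-identityˡ 1#) (sym (expTerm-zero (x + y))))
  expTerm-+ x y (suc n) = *-cancelˡ (0<⇒≢0 (fromℕ-suc-pos n)) (begin
    derivative (expTerm x ⋆ expTerm y) n
      ≡⟨ leibniz (expTerm x) (expTerm y) n ⟩
    (derivative (expTerm x) ⋆ expTerm y) n + (expTerm x ⋆ derivative (expTerm y)) n
      ≡⟨ cong₂ _+_ (⋆-scaleˡ x (expTerm y) (derivative-expTerm x) n) (⋆-scaleʳ y (expTerm x) (derivative-expTerm y) n) ⟩
    x * (expTerm x ⋆ expTerm y) n + y * (expTerm x ⋆ expTerm y) n
      ≡⟨ solve 3 (λ x y c → x :* c :+ y :* c := (x :+ y) :* c) refl x y ((expTerm x ⋆ expTerm y) n) ⟩
    (x + y) * (expTerm x ⋆ expTerm y) n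
      ≡⟨ cong ((x + y) *_) (expTerm-+ x y n) ⟩
    (x + y) * expTerm (x + y) n
      ≡⟨ derivative-expTerm (x + y) n ⟨
    derivative (expTerm (x + y)) n ∎)
    where open ≡-Reasoning

  -- Estimates for partial sums of Cauchy products.

  S-nonneg : ∀ {a} → (∀ k → 0# ≤ a k) → ∀ n → 0# ≤ S n a
  S-nonneg p zero    = ≤-refl
  S-nonneg p (suc n) = +-nonneg (S-nonneg p n) (p n)

  ⋆-nonneg : ∀ {a b} → (∀ k → 0# ≤ a k) → (∀ k → 0# ≤ b k) → ∀ n → 0# ≤ (a ⋆ b) n
  ⋆-nonneg p q zero    = *-nonneg (p 0) (q 0)
  ⋆-nonneg p q (suc n) = +-nonneg (*-nonneg (p 0) (q (suc n))) (⋆-nonneg (λ k → p (suc k)) q n)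

  nondecreasing : ∀ {u : ℕ → ℝ} → (∀ n → u n ≤ u (suc n)) → ∀ {m n} → m ℕ.≤ n → u m ≤ u n
  nondecreasing {u} p {m} m≤n = go (ℕ.≤⇒≤′ m≤n)
    where
    go : ∀ {n} → m ℕ.≤′ n → u m ≤ u n
    go (ℕ.≤′-reflexive refl) = ≤-refl
    go (ℕ.≤′-step m≤′n)      = ≤-trans (go m≤′n) (p _)

  S-step : ∀ {a} → (∀ k → 0# ≤ a k) → ∀ n → S n a ≤ S (suc n) a
  S-step {a} p n = ≤-by (a n) (p n) (solve 2 (λ s x → s :+ x :- s := x) refl (S n a) (a n))

  -- Every a i * b j with i < n and j < m occurs on the right, since i + j < n + m. The two lengths
  -- are independent because the induction shortens only the first factor.
  S-*-S-≤ : ∀ {a b} → (∀ k → 0# ≤ a k) → (∀ k → 0# ≤ b k) →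
    ∀ n m → S n a * S m b ≤ S (n ℕ.+ m) (a ⋆ b)
  S-*-S-≤ {a} {b} p q zero m = subst (_≤ S m (a ⋆ b)) (sym (zeroˡ (S m b))) (S-nonneg (⋆-nonneg p q) m)
  S-*-S-≤ {a} {b} p q (suc n) m = begin
    S (suc n) a * S m b
      ≡⟨ cong (_* S m b) (S-shift n a) ⟩
    (a 0 + S n (shift a)) * S m b
      ≡⟨ solve 3 (λ x s t → (x :+ s) :* t := x :* t :+ s :* t) refl (a 0) (S n (shift a)) (S m b) ⟩
    a 0 * S m b + S n (shift a) * S m b
      ≤⟨ +-mono-≤ (*-monoˡ-≤ (p 0) (nondecreasing {λ j → S j b} (S-step q) (ℕ.m≤n+m m (suc n))))
           (S-*-S-≤ (λ k → p (suc k)) q n m) ⟩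
    a 0 * S (suc (n ℕ.+ m)) b + S (n ℕ.+ m) (shift a ⋆ b)
      ≡⟨ S-⋆ (n ℕ.+ m) a b ⟨
    S (suc (n ℕ.+ m)) (a ⋆ b) ∎
    where open ≤-Reasoning

  S-tail-dominates : ∀ {A a} → (∀ k → Dominates (A k) (a k)) →
    ∀ {m n} → m ℕ.≤′ n → Dominates (S n A - S m A) (S n a - S m a)
  S-tail-dominates {A} {a} p {m} (ℕ.≤′-reflexive refl) = subst₂ Dominates (zero-diff (S m A)) (zero-diff (S m a)) (dominates-self ≤-refl)
    where
    zero-diff : ∀ x → 0# ≡ x - x
    zero-diff = solve 1 (λ x → con (+ 0) := x :- x) refl
  S-tail-dominates {A} {a} p {m} (ℕ.≤′-step {n} q) = subst₂ Dominates (rearrange (S n A) (S m A) (A n)) (rearrange (S n a) (S m a) (a n))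
    (Dominates-+ (S-tail-dominates p q) (p n))
    where
    rearrange : ∀ s t x → s - t + x ≡ s + x - t
    rearrange = solve 3 (λ s t x → s :- t :+ x := s :+ x :- t) refl

  -- The remainder is the sum of a i * b j over i < n, j < N, n ≤ i + j, so it
  -- is dominated term by term.
  product-remainder-dominates : ∀ {A a B b} → (∀ k → Dominates (A k) (a k)) → (∀ k → Dominates (B k) (b k)) →
    ∀ n N → n ℕ.≤ N → Dominates (S n A * S N B - S n (A ⋆ B)) (S n a * S N b - S n (a ⋆ b))
  product-remainder-dominates {A} {a} {B} {b} p q zero N _ = subst₂ Dominates (zero-diff (S N B)) (zero-diff (S N b)) (dominates-self ≤-refl)
    where
    zero-diff : ∀ x → 0# ≡ 0# * x - 0#
    zero-diff = solve 1 (λ x → con (+ 0) := con (+ 0) :* x :- con (+ 0)) refl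
  -- The terms with i = 0 are `a 0` times the tail of `b` from `suc n` to `N`; those with i > 0 form
  -- the remainder for `shift a` with `n` and the same `N`. Hence `N` has to be independent of `n`.
  product-remainder-dominates {A} {a} {B} {b} p q (suc n) N n<N = subst₂ Dominates (rearrange A B) (rearrange a b)
    (Dominates-+ (Dominates-* (p 0) (S-tail-dominates q (ℕ.≤⇒≤′ n<N)))
      (product-remainder-dominates (λ k → p (suc k)) q n N (ℕ.≤-trans (ℕ.n≤1+n n) n<N)))
    where
    open ≡-Reasoning
    rearrange : ∀ f g → f 0 * (S N g - S (suc n) g) + (S n (shift f) * S N g - S n (shift f ⋆ g))
      ≡ S (suc n) f * S N g - S (suc n) (f ⋆ g)
    rearrange f g = begin
      f 0 * (S N g - S (suc n) g) + (S n (shift f) * S N g - S n (shift f ⋆ g))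
        ≡⟨ solve 5 (λ x s t u v → x :* (s :- t) :+ (u :* s :- v) := (x :+ u) :* s :- (x :* t :+ v)) refl
             (f 0) (S N g) (S (suc n) g) (S n (shift f)) (S n (shift f ⋆ g)) ⟩
      (f 0 + S n (shift f)) * S N g - (f 0 * S (suc n) g + S n (shift f ⋆ g))
        ≡⟨ cong₂ (λ s t → s * S N g - t) (S-shift n f) (S-⋆ n f g) ⟨
      S (suc n) f * S N g - S (suc n) (f ⋆ g) ∎

  -- Limits of real sequences

  infix 4 _⇝_
  _⇝_ : (ℕ → ℝ) → ℝ → Set
  u ⇝ l = ∀ ε → 0# < ε → ∃[ m ] ∀ n → m ℕ.≤ n → Dominates ε (u n - l)

  ⇝-cong : ∀ {u v l} → (∀ n → u n ≡ v n) → u ⇝ l → v ⇝ l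
  ⇝-cong {l = l} eq u⇝l ε 0<ε with u⇝l ε 0<ε
  ... | m , p = m , λ n m≤n → subst (λ t → Dominates ε (t - l)) (eq n) (p n m≤n)

  ⇝-+ : ∀ {u v l m} → u ⇝ l → v ⇝ m → (λ n → u n + v n) ⇝ (l + m)
  ⇝-+ {u} {v} {l} {m} u⇝l v⇝m ε 0<ε with u⇝l _ (half-pos 0<ε) | v⇝m _ (half-pos 0<ε)
  ... | i , p | j , q = i ℕ.⊔ j , λ n i⊔j≤n → subst₂ Dominates (half ε)
    (solve 4 (λ u v l m → u :- l :+ (v :- m) := u :+ v :- (l :+ m)) refl (u n) (v n) l m)
    (Dominates-+ (p n (ℕ.m⊔n≤o⇒m≤o i j i⊔j≤n)) (q n (ℕ.m⊔n≤o⇒n≤o i j i⊔j≤n)))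

  ⇝-neg : ∀ {u l} → u ⇝ l → (λ n → - u n) ⇝ (- l)
  ⇝-neg {u} {l} u⇝l ε 0<ε with u⇝l ε 0<ε
  ... | m , p = m , λ n m≤n → subst (Dominates ε)
    (solve 2 (λ u l → :- (u :- l) := :- u :- :- l) refl (u n) l) (Dominates-neg (p n m≤n))

  ⇝-- : ∀ {u v l m} → u ⇝ l → v ⇝ m → (λ n → u n - v n) ⇝ (l - m)
  ⇝-- u⇝l v⇝m = ⇝-+ u⇝l (⇝-neg v⇝m)

  ⇝-* : ∀ {u v l m} → u ⇝ l → v ⇝ m → (λ n → u n * v n) ⇝ (l * m)
  ⇝-* {u} {v} {l} {m} u⇝l v⇝m ε 0<ε with dominated l | dominated m
  ... | L , 0≤L , L≥l | M , 0≤M , M≥m = i ℕ.⊔ j , λ n i⊔j≤n → Dominates-≤ bound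
      (subst (Dominates (δ * δ + (L * δ + M * δ)))
        (solve 4 (λ u v l m → (u :- l) :* (v :- m) :+ (l :* (v :- m) :+ m :* (u :- l)) := u :* v :- l :* m) refl (u n) (v n) l m)
        (let du = proj₂ (u⇝l δ 0<δ) n (ℕ.m⊔n≤o⇒m≤o i j i⊔j≤n)
             dv = proj₂ (v⇝m δ 0<δ) n (ℕ.m⊔n≤o⇒n≤o i j i⊔j≤n)
         in Dominates-+ (Dominates-* du dv) (Dominates-+ (Dominates-* L≥l dv) (Dominates-* M≥m du))))
    where
    -- The summand ε in `Q` ensures δ ≤ 1, so δ * δ ≤ δ, and the rest ensures (1 + L + M) δ ≤ ε.
    Q = 1# + L + M + ε
    0<Q : 0# < Q
    0<Q = +-pos (+-pos (+-pos 0<1 0≤L) 0≤M) (proj₁ 0<ε)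
    δ = Q ⁻¹ * ε
    0<δ : 0# < δ
    0<δ = *-pos (⁻¹-pos 0<Q) 0<ε
    i = proj₁ (u⇝l δ 0<δ)
    j = proj₁ (v⇝m δ 0<δ)
    Qδ≡ε : Q * δ ≡ ε
    Qδ≡ε = trans (sym (*-assoc Q (Q ⁻¹) ε))
      (trans (cong (_* ε) (⁻¹-inverseʳ Q (0<⇒≢0 0<Q))) (*-identityˡ ε))
    δ≤1 : δ ≤ 1#
    δ≤1 = *-cancelˡ-≤ 0<Q (subst₂ _≤_ (sym Qδ≡ε) (sym (*-identityʳ Q))
      (≤-by (1# + L + M) (+-nonneg (+-nonneg 0≤1 0≤L) 0≤M)
        (solve 2 (λ p ε → p :+ ε :- ε := p) refl (1# + L + M) ε)))
    bound : δ * δ + (L * δ + M * δ) ≤ ε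
    bound = begin
      δ * δ + (L * δ + M * δ)   ≤⟨ +-monoˡ-≤ _ (*-monoʳ-≤ (proj₁ 0<δ) δ≤1) ⟩
      1# * δ + (L * δ + M * δ)  ≤⟨ ≤-by (ε * δ) (*-nonneg (proj₁ 0<ε) (proj₁ 0<δ))
                                     (solve 4 (λ L M e d → (con (+ 1) :+ L :+ M :+ e) :* d
                                         :- (con (+ 1) :* d :+ (L :* d :+ M :* d)) := e :* d) refl L M ε δ) ⟩
      Q * δ                     ≡⟨ Qδ≡ε ⟩
      ε                         ∎
      where open ≤-Reasoning

  ⇝-nonneg : ∀ {u l} → (∀ n → 0# ≤ u n) → u ⇝ l → 0# ≤ l
  ⇝-nonneg {u} {l} 0≤u u⇝l = ≤-from-ε λ ε 0<ε →
    let m , p = u⇝l ε 0<ε in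
    ≤-by (u m + (ε - (u m - l))) (+-nonneg (0≤u m) (Dominates.upper (p m ℕ.≤-refl)))
      (solve 3 (λ u l e → l :+ e :- con (+ 0) := u :+ (e :- (u :- l))) refl (u m) l ε)

  0≤-⇒≤ : ∀ {x y} → 0# ≤ y - x → x ≤ y
  0≤-⇒≤ p = ≤-by _ p refl

  ⇝-mono : ∀ {u v l m} → (∀ n → u n ≤ v n) → u ⇝ l → v ⇝ m → l ≤ m
  ⇝-mono u≤v u⇝l v⇝m = 0≤-⇒≤ (⇝-nonneg (λ n → ≤⇒0≤- (u≤v n)) (⇝-- v⇝m u⇝l))

  ⇝-unique : ∀ {u l m} → u ⇝ l → u ⇝ m → l ≡ m
  ⇝-unique u⇝l u⇝m = ≤-antisym (⇝-mono (λ _ → ≤-refl) u⇝l u⇝m) (⇝-mono (λ _ → ≤-refl) u⇝m u⇝l)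

  ⇝-const : ∀ l → (λ _ → l) ⇝ l
  ⇝-const l ε 0<ε = 0 , λ _ _ → dominates
    (subst (0# ≤_) (solve 2 (λ e l → e := e :+ (l :- l)) refl ε l) (proj₁ 0<ε))
    (subst (0# ≤_) (solve 2 (λ e l → e := e :- (l :- l)) refl ε l) (proj₁ 0<ε))

  ⇝-dominates : ∀ {U u L l} → (∀ n → Dominates (U n) (u n)) → U ⇝ L → u ⇝ l → Dominates L l
  ⇝-dominates p U⇝L u⇝l = dominates
    (⇝-nonneg (λ n → Dominates.lower (p n)) (⇝-+ U⇝L u⇝l))
    (⇝-nonneg (λ n → Dominates.upper (p n)) (⇝-- U⇝L u⇝l))

  bounded-nondecreasing-converges : ∀ {u} B → (∀ n → u n ≤ u (suc n)) → (∀ n → u n ≤ B) →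
    ∃[ l ] (u ⇝ l × ∀ n → u n ≤ l)
  bounded-nondecreasing-converges {u} B mono bounded = l , converges , below
    where
    P : ℝ → Set
    P t = ∃[ n ] t ≡ u n
    lub : ∃ (IsLub P)
    lub = complete P (u 0 , 0 , refl) (B , λ { t (n , refl) → bounded n })
    l = proj₁ lub
    below : ∀ n → u n ≤ l
    below n = proj₁ (proj₂ lub) (u n) (n , refl)
    converges : u ⇝ l
    converges ε 0<ε with lem {∃[ n ] l - ε ≤ u n}
    ... | yes (m , p) = m , λ n m≤n → dominates
      (subst (0# ≤_) (solve 3 (λ u l e → u :- (l :- e) := e :+ (u :- l)) refl (u n) l ε)
        (≤⇒0≤- (≤-trans p (nondecreasing {u} mono m≤n))))
      (subst (0# ≤_) (solve 3 (λ u l e → e :+ (l :- u) := e :- (u :- l)) refl (u n) l ε)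
        (+-nonneg (proj₁ 0<ε) (≤⇒0≤- (below n))))
    ... | no ¬p = contradiction
      (≤-by (l - ε - l) (≤⇒0≤- (proj₂ (proj₂ lub) (l - ε) (λ { t (n , refl) → proj₁ (≰⇒> (λ q → ¬p (n , q))) })))
        (solve 2 (λ l e → con (+ 0) :- e := l :- e :- l) refl l ε))
      (<⇒≱ 0<ε)

  -- The terms `A k + a k` are nonnegative and their partial sums are at most `B + B`, so this
  -- series converges by monotonicity, as does that of `A`; the series of `a` is the difference.
  dominated-series-converges : ∀ {A a} B → (∀ k → Dominates (A k) (a k)) → (∀ k → 0# ≤ A k) →
    (∀ n → S n A ≤ B) → ∃[ l ] (λ n → S n a) ⇝ l
  dominated-series-converges {A} {a} B dom 0≤A bounded =
    let L , A⇝L , _ = bounded-nondecreasing-converges B (S-step 0≤A) bounded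
        l , w⇝l , _ = bounded-nondecreasing-converges {λ n → S n A + S n a} (B + B) (λ n → step n)
                        (λ n → +-mono-≤ (bounded n) (≤-trans (≤-by _ (Dominates.upper (S-dominates n)) refl) (bounded n)))
    in l - L , ⇝-cong (λ n → solve 2 (λ x y → x :+ y :- x := y) refl (S n A) (S n a)) (⇝-- w⇝l A⇝L)
    where
    S-dominates : ∀ n → Dominates (S n A) (S n a)
    S-dominates zero    = dominates-self ≤-refl
    S-dominates (suc n) = Dominates-+ (S-dominates n) (dom n)
    step : ∀ n → S n A + S n a ≤ S (suc n) A + S (suc n) a
    step n = ≤-by _ (Dominates.lower (dom n))
      (solve 4 (λ s t x y → s :+ x :+ (t :+ y) :- (s :+ t) := x :+ y) refl (S n A) (S n a) (A n) (a n))

  -- The exponential series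

  expTerm-dominates : ∀ {X x} → Dominates X x → ∀ k → Dominates (expTerm X k) (expTerm x k)
  expTerm-dominates {X} {x} X≥x k = Dominates-* (dominates-self (proj₁ (⁻¹-pos (fact-pos k)))) (power k)
    where
    power : ∀ k → Dominates (X ^ k) (x ^ k)
    power zero    = dominates-self 0≤1
    power (suc k) = Dominates-* X≥x (power k)

  expTerm-nonneg : ∀ {x} → 0# ≤ x → ∀ k → 0# ≤ expTerm x k
  expTerm-nonneg {x} 0≤x k = *-nonneg (proj₁ (⁻¹-pos (fact-pos k))) (power k)
    where
    power : ∀ k → 0# ≤ x ^ k
    power zero    = 0≤1
    power (suc k) = *-nonneg 0≤x (power k)

  -- Once 2x ≤ n the terms at least halve, so S n + 2 * expTerm x n no longer increases.
  exp-series-bounded : ∀ {x} → 0# ≤ x → ∃[ B ] ∀ n → S n (expTerm x) ≤ B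
  exp-series-bounded {x} 0≤x = G N , λ n → begin
      S n t             ≤⟨ nondecreasing {λ n → S n t} (S-step 0≤t) (ℕ.m≤n+m n N) ⟩
      S (N ℕ.+ n) t     ≤⟨ ≤-by (t (N ℕ.+ n) + t (N ℕ.+ n)) (+-nonneg (0≤t (N ℕ.+ n)) (0≤t (N ℕ.+ n)))
                             (solve 2 (λ s x → s :+ x :- s := x) refl _ _) ⟩
      G (N ℕ.+ n)       ≤⟨ bound n ⟩
      G N               ∎
    where
    open ≤-Reasoning
    t = expTerm x
    0≤t : ∀ k → 0# ≤ t k
    0≤t = expTerm-nonneg 0≤x
    N = proj₁ (archimedean (x + x))
    G : ℕ → ℝ
    G n = S n t + (t n + t n)
    halving : ∀ n → N ℕ.≤ n → t (suc n) + t (suc n) ≤ t n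
    halving n N≤n = *-cancelˡ-≤ (fromℕ-suc-pos n) (begin
      fromℕ (suc n) * (t (suc n) + t (suc n))
        ≡⟨ solve 2 (λ f y → f :* (y :+ y) := f :* y :+ f :* y) refl (fromℕ (suc n)) (t (suc n)) ⟩
      derivative t n + derivative t n
        ≡⟨ cong (λ d → d + d) (derivative-expTerm x n) ⟩
      x * t n + x * t n
        ≡⟨ solve 2 (λ x y → x :* y :+ x :* y := (x :+ x) :* y) refl x (t n) ⟩
      (x + x) * t n
        ≤⟨ *-monoʳ-≤ (0≤t n) (≤-trans (proj₂ (archimedean (x + x))) (fromℕ-mono (ℕ.≤-trans N≤n (ℕ.n≤1+n n)))) ⟩
      fromℕ (suc n) * t n ∎)
    bound : ∀ n → G (N ℕ.+ n) ≤ G N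
    bound zero    = ≤-reflexive (cong G (ℕ.+-identityʳ N))
    bound (suc n) = begin
      G (N ℕ.+ suc n)    ≡⟨ cong G (ℕ.+-suc N n) ⟩
      G (suc (N ℕ.+ n))  ≤⟨ +-monoʳ-≤ _ (halving (N ℕ.+ n) (ℕ.m≤m+n N n)) ⟩
      S (N ℕ.+ n) t + t (N ℕ.+ n) + t (N ℕ.+ n)  ≡⟨ +-assoc _ _ _ ⟩
      G (N ℕ.+ n)        ≤⟨ bound n ⟩
      G N                ∎

  exp-series-converges : ∀ x → ∃[ l ] (λ n → S n (expTerm x)) ⇝ l
  exp-series-converges x =
    let X , 0≤X , X≥x = dominated x
        B , bounded = exp-series-bounded 0≤X
    in dominated-series-converges B (expTerm-dominates X≥x) (expTerm-nonneg 0≤X) bounded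

  -- The complex norm, limits and exponential on the real axis

  choose-spec : ∀ {A : Set} {P : A → Set} d → ∃ P → P (choose P d)
  choose-spec {P = P} d ∃P with lem {∃ P}
  ... | yes (_ , p) = p
  ... | no  ¬∃P     = contradiction ∃P ¬∃P

  sup-lub : ∀ {P} → ∃ P → ∃ (IsUpperBound P) → IsLub P (sup P)
  sup-lub {P} ∃P bounded = choose-spec 0# (complete P ∃P bounded)

  -- The set contains 0, and `1# + y` bounds it because 2 (1 + y - t) = 2 (y - t²) + 1 + t² + (1 -
  -- t)².
  √-lub : ∀ {y} → 0# ≤ y → IsLub (λ t → t * t ≤ y) (√ y)
  √-lub {y} 0≤y = sup-lub (0# , subst (_≤ y) (sym (zeroˡ 0#)) 0≤y) (1# + y , λ t t²≤y →
    0≤-⇒≤ (halve-nonneg (subst (0# ≤_)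
      (solve 2 (λ y t → y :- t :* t :+ (y :- t :* t) :+ (con (+ 1) :+ t :* t :+ (con (+ 1) :- t) :* (con (+ 1) :- t))
        := con (+ 1) :+ y :- t :+ (con (+ 1) :+ y :- t)) refl y t)
      (+-nonneg (+-nonneg (≤⇒0≤- t²≤y) (≤⇒0≤- t²≤y)) (+-nonneg (+-nonneg 0≤1 (0≤x*x t)) (0≤x*x (1# - t)))))))

  ∥∥-lub : ∀ z → IsLub (λ t → t * t ≤ re z * re z + im z * im z) ∥ z ∥
  ∥∥-lub z = √-lub (+-nonneg (0≤x*x (re z)) (0≤x*x (im z)))

  ∥∥-nonneg : ∀ z → 0# ≤ ∥ z ∥
  ∥∥-nonneg z = proj₁ (∥∥-lub z) 0# (subst (_≤ re z * re z + im z * im z) (sym (zeroˡ 0#))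
    (+-nonneg (0≤x*x (re z)) (0≤x*x (im z))))

  ∥∥-dominates-re : ∀ z → Dominates ∥ z ∥ (re z)
  ∥∥-dominates-re z = dominates-intro
    (proj₁ (∥∥-lub z) (- re z) (subst (_≤ re z * re z + im z * im z) (neg-square (re z)) square≤))
    (proj₁ (∥∥-lub z) (re z) square≤)
    where
    neg-square : ∀ x → x * x ≡ - x * - x
    neg-square = solve 1 (λ x → x :* x := :- x :* :- x) refl
    square≤ : re z * re z ≤ re z * re z + im z * im z
    square≤ = subst (_≤ re z * re z + im z * im z) (+-identityʳ (re z * re z)) (+-monoʳ-≤ (re z * re z) (0≤x*x (im z)))

  ∥∥-≤ : ∀ {B} z → 0# ≤ B → im z ≡ 0# → Dominates B (re z) → ∥ z ∥ ≤ B
  ∥∥-≤ {B} (x +i _) 0≤B refl B≥x = proj₂ (∥∥-lub (x +i 0#)) B λ t t²≤ →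
    square-cancel-≤ 0≤B (≤-trans t²≤ (subst (_≤ B * B)
      (solve 1 (λ x → x :* x := x :* x :+ con (+ 0) :* con (+ 0)) refl x)
      (0≤-⇒≤ (Dominates.upper (Dominates-* B≥x B≥x)))))

  ⟶-re : ∀ {u l} → u ⟶ l → (λ n → re (u n)) ⇝ re l
  ⟶-re {u} {l} u⟶l ε 0<ε with u⟶l ε 0<ε
  ... | m , p = m , λ n m≤n → Dominates-≤ (proj₁ (p n m≤n)) (∥∥-dominates-re (u n -ᶜ l))

  ⟶-ofℝ : ∀ {u l} → u ⇝ l → (λ n → ofℝ (u n)) ⟶ ofℝ l
  -- Halving ε turns the weak inequality of `_⇝_` into the strict one of `_⟶_`.
  ⟶-ofℝ {u} {l} u⇝l ε 0<ε with u⇝l _ (half-pos 0<ε)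
  ... | m , p = m , λ n m≤n → ≤-<-trans
    (∥∥-≤ (ofℝ (u n) -ᶜ ofℝ l) (proj₁ (half-pos 0<ε)) (solve 0 (con (+ 0) :- con (+ 0) := con (+ 0)) refl) (p n m≤n))
    (half-< 0<ε)

  ofℝ-* : ∀ x y → ofℝ x *ᶜ ofℝ y ≡ ofℝ (x * y)
  ofℝ-* x y = cong₂ _+i_
    (solve 2 (λ x y → x :* y :- con (+ 0) :* con (+ 0) := x :* y) refl x y)
    (solve 2 (λ x y → x :* con (+ 0) :+ con (+ 0) :* y := con (+ 0)) refl x y)

  ofℝ-^ : ∀ x k → ofℝ x ^ᶜ k ≡ ofℝ (x ^ k)
  ofℝ-^ x zero    = refl
  ofℝ-^ x (suc k) = trans (cong (ofℝ x *ᶜ_) (ofℝ-^ x k)) (ofℝ-* x (x ^ k))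

  expPartial : ℂ → ℕ → ℂ
  expPartial z n = sum< n (λ k → ofℝ (fromℕ (k !) ⁻¹) *ᶜ z ^ᶜ k)

  expPartial-ofℝ : ∀ x n → expPartial (ofℝ x) n ≡ ofℝ (S n (expTerm x))
  expPartial-ofℝ x zero    = refl
  expPartial-ofℝ x (suc n) = trans
    (cong₂ _+ᶜ_ (expPartial-ofℝ x n) (trans (cong (ofℝ (fromℕ (n !) ⁻¹) *ᶜ_) (ofℝ-^ x n)) (ofℝ-* (fromℕ (n !) ⁻¹) (x ^ n))))
    (cong (S n (expTerm x) + expTerm x n +i_) (+-identityˡ 0#))

  ⟶-cong : ∀ {u v l} → (∀ n → u n ≡ v n) → u ⟶ l → v ⟶ l
  ⟶-cong {l = l} eq u⟶l ε 0<ε with u⟶l ε 0<ε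
  ... | m , p = m , λ n m≤n → subst (λ z → ∥ z -ᶜ l ∥ < ε) (eq n) (p n m≤n)

  ⟶-lim : ∀ {u} → ∃ (u ⟶_) → u ⟶ lim u
  ⟶-lim {u} = choose-spec {P = u ⟶_} 0ᶜ

  -- `lim` is known to be a limit only once some limit is exhibited. The limit of the real series,
  -- placed on the real axis, is one; taking real parts then returns to `expʳ`.
  expʳ-limit : ∀ x → (λ n → S n (expTerm x)) ⇝ expʳ x
  expʳ-limit x =
    let l , S⇝l = exp-series-converges x
        converges = ⟶-cong {l = ofℝ l} (λ n → sym (expPartial-ofℝ x n)) (⟶-ofℝ S⇝l)
    in ⇝-cong (λ n → cong re (expPartial-ofℝ x n))
         (⟶-re {expPartial (ofℝ x)} {exp (ofℝ x)} (⟶-lim {expPartial (ofℝ x)} (ofℝ l , converges)))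

  -- The real exponential and logarithm

  S-≤-expʳ : ∀ {x} → 0# ≤ x → ∀ n → S n (expTerm x) ≤ expʳ x
  S-≤-expʳ {x} 0≤x n =
    let B , bounded = exp-series-bounded 0≤x
        l , S⇝l , S≤l = bounded-nondecreasing-converges B (S-step (expTerm-nonneg 0≤x)) bounded
    in subst (S n (expTerm x) ≤_) (⇝-unique S⇝l (expʳ-limit x)) (S≤l n)

  expʳ-supermultiplicative : ∀ {x y} → 0# ≤ x → 0# ≤ y → expʳ x * expʳ y ≤ expʳ (x + y)
  expʳ-supermultiplicative {x} {y} 0≤x 0≤y = ⇝-mono (λ n → begin
    S n (expTerm x) * S n (expTerm y)
      ≤⟨ S-*-S-≤ (expTerm-nonneg 0≤x) (expTerm-nonneg 0≤y) n n ⟩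
    S (n ℕ.+ n) (expTerm x ⋆ expTerm y)
      ≡⟨ S-cong (n ℕ.+ n) (expTerm-+ x y) ⟩
    S (n ℕ.+ n) (expTerm (x + y))
      ≤⟨ S-≤-expʳ (+-nonneg 0≤x 0≤y) (n ℕ.+ n) ⟩
    expʳ (x + y) ∎)
    (⇝-* (expʳ-limit x) (expʳ-limit y)) (⇝-const _)
    where open ≤-Reasoning

  product-remainder-limit : ∀ x y →
    (λ n → S n (expTerm x) * S n (expTerm y) - S n (expTerm x ⋆ expTerm y)) ⇝ expʳ x * expʳ y - expʳ (x + y)
  product-remainder-limit x y = ⇝-- (⇝-* (expʳ-limit x) (expʳ-limit y))
    (⇝-cong (λ n → sym (S-cong n (expTerm-+ x y))) (expʳ-limit (x + y)))

  expʳ-+ : ∀ x y → expʳ (x + y) ≡ expʳ x * expʳ y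
  expʳ-+ x y with dominated x | dominated y
  ... | X , 0≤X , X≥x | Y , 0≤Y , Y≥y = sym (dominated-difference
    (⇝-dominates
      (λ n → product-remainder-dominates (expTerm-dominates X≥x) (expTerm-dominates Y≥y) n n ℕ.≤-refl)
      (product-remainder-limit X Y) (product-remainder-limit x y))
    (expʳ-supermultiplicative 0≤X 0≤Y))

  1+x≤expʳ : ∀ {x} → 0# ≤ x → 1# + x ≤ expʳ x
  1+x≤expʳ {x} 0≤x = subst (_≤ expʳ x) (begin
    0# + expTerm x 0 + expTerm x 1
      ≡⟨ cong₂ _+_ (+-identityˡ _) (solve 1 (λ t → t := (con (+ 1) :+ con (+ 0)) :* t) refl (expTerm x 1)) ⟩
    expTerm x 0 + derivative (expTerm x) 0
      ≡⟨ cong (λ t → expTerm x 0 + t) (derivative-expTerm x 0) ⟩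
    expTerm x 0 + x * expTerm x 0
      ≡⟨ cong (λ t → t + x * t) (expTerm-zero x) ⟩
    1# + x * 1#
      ≡⟨ cong (λ t → 1# + t) (*-identityʳ x) ⟩
    1# + x ∎) (S-≤-expʳ 0≤x 2)
    where open ≡-Reasoning

  1≤expʳ : ∀ {x} → 0# ≤ x → 1# ≤ expʳ x
  1≤expʳ {x} 0≤x = ≤-trans (≤-by x 0≤x (solve 1 (λ x → con (+ 1) :+ x :- con (+ 1) := x) refl x)) (1+x≤expʳ 0≤x)

  -- Cancel `expʳ 0#`, which is at least 1, from its own square.
  expʳ-0 : expʳ 0# ≡ 1#
  expʳ-0 = *-cancelˡ (0<⇒≢0 (<-≤-trans 0<1 (1≤expʳ ≤-refl)))
    (trans (sym (expʳ-+ 0# 0#)) (trans (cong expʳ (+-identityˡ 0#)) (sym (*-identityʳ _))))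

  -- Nonnegative as the square of `expʳ (two ⁻¹ * x)`, and nonzero because `expʳ (- x)` is an
  -- inverse.
  expʳ-pos : ∀ x → 0# < expʳ x
  expʳ-pos x = subst (0# ≤_) (trans (sym (expʳ-+ _ _)) (cong expʳ (half x))) (0≤x*x (expʳ (two ⁻¹ * x)))
    , λ 0≡e → 0≢1 (begin
        0#                    ≡⟨ zeroˡ _ ⟨
        0# * expʳ (- x)       ≡⟨ cong (_* expʳ (- x)) 0≡e ⟩
        expʳ x * expʳ (- x)   ≡⟨ expʳ-+ x (- x) ⟨
        expʳ (x - x)          ≡⟨ cong expʳ (solve 1 (λ x → x :- x := con (+ 0)) refl x) ⟩
        expʳ 0#               ≡⟨ expʳ-0 ⟩
        1#                    ∎)
    where open ≡-Reasoning

  expʳ-mono : ∀ {x y} → x ≤ y → expʳ x ≤ expʳ y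
  expʳ-mono {x} {y} x≤y = begin
    expʳ x                 ≡⟨ *-identityʳ _ ⟨
    expʳ x * 1#            ≤⟨ *-monoˡ-≤ (proj₁ (expʳ-pos x)) (1≤expʳ (≤⇒0≤- x≤y)) ⟩
    expʳ x * expʳ (y - x)  ≡⟨ expʳ-+ x (y - x) ⟨
    expʳ (x + (y - x))     ≡⟨ cong expʳ (solve 2 (λ x y → x :+ (y :- x) := y) refl x y) ⟩
    expʳ y                 ∎
    where open ≤-Reasoning

  -- The assumption `1# ≤ y` puts 0 into the set, and `1# + t ≤ expʳ t` makes `y` itself an upper
  -- bound.
  log-lub : ∀ {y} → 1# ≤ y → IsLub (λ t → expʳ t ≤ y) (log y)
  log-lub {y} 1≤y = sup-lub (0# , subst (_≤ y) (sym expʳ-0) 1≤y) (y , bound)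
    where
    bound : ∀ t → expʳ t ≤ y → t ≤ y
    bound t e≤y with ≤-total 0# t
    ... | inj₁ 0≤t = ≤-trans (≤-by 1# 0≤1 (solve 1 (λ t → con (+ 1) :+ t :- t := con (+ 1)) refl t))
                       (≤-trans (1+x≤expʳ 0≤t) e≤y)
    ... | inj₂ t≤0 = ≤-trans t≤0 (≤-trans 0≤1 1≤y)

  1≤log : ∀ {x} → expʳ 1# ≤ x → 1# ≤ log x
  1≤log e≤x = proj₁ (log-lub (≤-trans (1≤expʳ 0≤1) e≤x)) 1# e≤x

  -- Otherwise `log y + 1#` would still lie in the set of which `log y` is the supremum. A whole
  -- unit step avoids any appeal to continuity of `expʳ`.
  ≤expʳ-log : ∀ {y} → 1# ≤ y → y ≤ expʳ (log y) * expʳ 1#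
  ≤expʳ-log {y} 1≤y = ≤-stable λ e<y → <⇒≱ 0<1
    (≤-by _ (≤⇒0≤- (proj₁ (log-lub 1≤y) (log y + 1#) (subst (_≤ y) (sym (expʳ-+ (log y) 1#)) (proj₁ e<y))))
      (solve 1 (λ l → con (+ 0) :- con (+ 1) := l :- (l :+ con (+ 1))) refl (log y)))

  -- Sums over finite lists and sets

  sumOver : ∀ {A : Set} → (A → ℝ) → List A → ℝ
  sumOver f l = foldr _+_ 0# (map f l)

  sumOver-filter : ∀ {A : Set} {P : A → Set} (P? : Decidable P) (f : A → ℝ) l →
    sumOver f l ≡ sumOver f (filter P? l) + sumOver f (filter (∁? P?) l)
  sumOver-filter P? f []      = sym (+-identityˡ 0#)
  sumOver-filter P? f (a ∷ l) with P? a
  ... | yes _ = trans (cong (λ t → f a + t) (sumOver-filter P? f l)) (sym (+-assoc _ _ _))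
  ... | no  _ = trans (cong (λ t → f a + t) (sumOver-filter P? f l))
    (solve 3 (λ x s t → x :+ (s :+ t) := s :+ (x :+ t)) refl
      (f a) (sumOver f (filter P? l)) (sumOver f (filter (∁? P?) l)))

  sumOver-≤-scale : ∀ {A : Set} {g f : A → ℝ} W {l} → All (λ a → g a ≤ W * f a) l → sumOver g l ≤ W * sumOver f l
  sumOver-≤-scale W []ᵃ = ≤-reflexive (sym (zeroʳ W))
  sumOver-≤-scale {g = g} {f} W {a ∷ l} (p ∷ᵃ ps) = subst (sumOver g (a ∷ l) ≤_)
    (solve 3 (λ w x s → w :* x :+ w :* s := w :* (x :+ s)) refl W (f a) (sumOver f l))
    (+-mono-≤ p (sumOver-≤-scale W ps))

  -- The working form of "the sum exists and is at most `B`". The two lemmas that follow show the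
  -- equivalence; the direction that produces a sum is the one using completeness.
  SumsBounded : ∀ {A : Set} → (A → Set) → (A → ℝ) → ℝ → Set
  SumsBounded P f B = ∀ l → Unique l → All P l → sumOver f l ≤ B

  bounded⇒sum : ∀ {A : Set} {P : A → Set} {f : A → ℝ} {B} → SumsBounded P f B → ∃[ v ] (IsSum P f v × v ≤ B)
  bounded⇒sum {P = P} {f} {B} bounded = v , lub , proj₂ lub B upper
    where
    upper : IsUpperBound (IsFiniteSubsum P f) B
    upper t (l , unique , all , refl) = bounded l unique all
    ∃lub = complete (IsFiniteSubsum P f) (0# , [] , []ᵘ , []ᵃ , refl) (B , upper)
    v = proj₁ ∃lub
    lub = proj₂ ∃lub

  sum⇒bounded : ∀ {A : Set} {P : A → Set} {f : A → ℝ} {B} → ∃[ v ] (IsSum P f v × v ≤ B) → SumsBounded P f B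
  sum⇒bounded (v , lub , v≤B) l unique all = ≤-trans (proj₁ lub _ (l , unique , all , refl)) v≤B

  -- Cut the range of β into layers of width h; on the layer from k h to
  -- (k + 1) h the weight is at most its value at the upper end.
  layered-sum-≤ : ∀ {A : Set} {P : A → Set} {β f : A → ℝ} {w : ℝ → ℝ} {h E} K →
    (∀ {a} → P a → 0# < β a) → (∀ a → 0# ≤ f a) →
    (∀ {s t} → s ≤ t → w s ≤ w t) →
    (∀ k → k ℕ.< K → ∀ l → Unique l → All (λ a → P a × fromℕ k * h ≤ β a) l →
      w (fromℕ (suc k) * h) * sumOver f l ≤ E) →
    SumsBounded (λ a → P a × β a ≤ fromℕ K * h) (λ a → w (β a) * f a) (fromℕ K * E)
  layered-sum-≤ {E = E} zero β-pos 0≤f w-mono layer [] _ _ = ≤-reflexive (sym (zeroˡ E))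
  -- With no layers left, `β a ≤ 0#` contradicts positivity, so the list must be empty.
  layered-sum-≤ {h = h} zero β-pos 0≤f w-mono layer (a ∷ l) _ ((Pa , βa≤) ∷ᵃ _) =
    contradiction (subst (_ ≤_) (zeroˡ h) βa≤) (<⇒≱ (β-pos Pa))
  layered-sum-≤ {A} {P} {β} {f} {w} {h} {E} (suc k) β-pos 0≤f w-mono layer l unique all = begin
    -- Split off the top layer; a β on the boundary goes to the upper side, so nothing is counted
    -- twice. The upper end of the layer serves to bound the weight, after which `layer` needs only
    -- the lower end.
    sumOver g l                                    ≡⟨ sumOver-filter Q? g l ⟩
    sumOver g (filter Q? l) + sumOver g (filter (∁? Q?) l)
      ≤⟨ +-mono-≤
           (≤-trans (sumOver-≤-scale (w (fromℕ (suc k) * h))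
              (All.map (λ {a} (_ , β≤) → *-monoʳ-≤ (0≤f a) (w-mono β≤)) (filterᵃ⁺ Q? all)))
             (layer k ℕ.≤-refl (filter Q? l) (filterᵘ⁺ Q? unique)
               (All.zip (All.map proj₁ (filterᵃ⁺ Q? all) , all-filter Q? l))))
           (layered-sum-≤ k β-pos 0≤f w-mono (λ j j<k → layer j (ℕ.≤-trans j<k (ℕ.n≤1+n k)))
             (filter (∁? Q?) l) (filterᵘ⁺ (∁? Q?) unique)
             (All.map (λ ((Pa , _) , ¬Q) → Pa , proj₁ (≰⇒> ¬Q)) (All.zip (filterᵃ⁺ (∁? Q?) all , all-filter (∁? Q?) l)))) ⟩
    E + fromℕ k * E                                ≡⟨ solve 2 (λ e k → e :+ k :* e := (con (+ 1) :+ k) :* e) refl E (fromℕ k) ⟩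
    fromℕ (suc k) * E                              ∎
    where
    open ≤-Reasoning
    g : A → ℝ
    g a = w (β a) * f a
    Q? : Decidable (λ a → fromℕ k * h ≤ β a)
    Q? a = lem

  -- No sign of the implied constant is given; the empty list at σ = 1, where the power equals 1,
  -- supplies it.
  tail-constant-nonneg : ∀ {A : Set} {P : A → Set} {f : A → ℝ} {B L} →
    SumsBounded P f (expʳ ((1# - 1#) * L) * B) → 0# ≤ B
  tail-constant-nonneg {B = B} {L} bound = subst (0# ≤_) (begin
    expʳ ((1# - 1#) * L) * B  ≡⟨ cong (λ t → expʳ t * B) (vanish L) ⟩
    expʳ 0# * B               ≡⟨ cong (λ t → t * B) expʳ-0 ⟩
    1# * B                    ≡⟨ *-identityˡ B ⟩
    B                         ∎)
    (bound [] []ᵘ []ᵃ)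
    where
    open ≡-Reasoning
    vanish : ∀ l → (1# - 1#) * l ≡ 0#
    vanish = solve 1 (λ l → (con (+ 1) :- con (+ 1)) :* l := con (+ 0)) refl

  -- The layer argument for the weight exp ((β - 1) L).

  module _ {A : Set} {P : A → Set} {β f : A → ℝ} {B L : ℝ}
    (β-pos : ∀ {a} → P a → 0# < β a) (β≤1 : ∀ {a} → P a → β a ≤ 1#) (0≤f : ∀ a → 0# ≤ f a) (1≤L : 1# ≤ L)
    (tail-bound : ∀ σ → 0# ≤ σ → σ ≤ 1# → SumsBounded (λ a → P a × σ ≤ β a) f (expʳ ((1# - σ) * L) * B))
    where

    exp-weighted-sum-≤ : SumsBounded P (λ a → expʳ ((β a - 1#) * L) * f a) (two * expʳ 1# * B * L)
    exp-weighted-sum-≤ l unique all = ≤-trans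
      (layered-sum-≤ {w = λ t → expʳ ((t - 1#) * L)} K β-pos 0≤f
        (λ s≤t → expʳ-mono (*-monoʳ-≤ 0≤L (+-monoˡ-≤ (- 1#) s≤t))) layer
        l unique (All.map (λ {a} Pa → Pa , subst (β a ≤_) (sym Kh≡1) (β≤1 Pa)) all))
      (begin
        -- Rounding L up costs at most 1, which `1# ≤ L` turns into a factor of 2.
        fromℕ K * (expʳ 1# * B)     ≤⟨ *-monoʳ-≤ 0≤eB (≤-trans K≤L+1 (+-monoʳ-≤ L 1≤L)) ⟩
        (L + L) * (expʳ 1# * B)     ≡⟨ regroup L (expʳ 1#) B ⟩
        two * expʳ 1# * B * L       ∎)
      where
      open ≤-Reasoning
      regroup : ∀ l e b → (l + l) * (e * b) ≡ two * e * b * l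
      regroup = solve 3 (λ l e b → (l :+ l) :* (e :* b) := con (+ 2) :* e :* b :* l) refl
      0≤L : 0# ≤ L
      0≤L = ≤-trans 0≤1 1≤L
      0≤B : 0# ≤ B
      0≤B = tail-constant-nonneg (tail-bound 1# 0≤1 ≤-refl)
      0≤eB : 0# ≤ expʳ 1# * B
      0≤eB = *-nonneg (proj₁ (expʳ-pos 1#)) 0≤B
      K = proj₁ (ceiling L 0≤L)
      L≤K : L ≤ fromℕ K
      L≤K = proj₁ (proj₂ (ceiling L 0≤L))
      K≤L+1 : fromℕ K ≤ L + 1#
      K≤L+1 = proj₂ (proj₂ (ceiling L 0≤L))
      0<K : 0# < fromℕ K
      0<K = <-≤-trans 0<1 (≤-trans 1≤L L≤K)
      h = fromℕ K ⁻¹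
      0≤h : 0# ≤ h
      0≤h = proj₁ (⁻¹-pos 0<K)
      Kh≡1 : fromℕ K * h ≡ 1#
      Kh≡1 = ⁻¹-inverseʳ (fromℕ K) (0<⇒≢0 0<K)
      hL≤1 : h * L ≤ 1#
      hL≤1 = ≤-trans (*-monoˡ-≤ 0≤h L≤K) (≤-reflexive (*-inverseˡ (0<⇒≢0 0<K)))
      layer : ∀ k → k ℕ.< K → ∀ l → Unique l → All (λ a → P a × fromℕ k * h ≤ β a) l →
        expʳ ((fromℕ (suc k) * h - 1#) * L) * sumOver f l ≤ expʳ 1# * B
      layer k k<K l unique all = begin
        expʳ ((fromℕ (suc k) * h - 1#) * L) * sumOver f l
          ≤⟨ *-monoˡ-≤ (proj₁ (expʳ-pos _)) (tail-bound σ (*-nonneg (fromℕ-nonneg k) 0≤h)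
               (≤-trans (*-monoʳ-≤ 0≤h (fromℕ-mono (ℕ.<⇒≤ k<K))) (≤-reflexive Kh≡1)) l unique all) ⟩
        expʳ ((fromℕ (suc k) * h - 1#) * L) * (expʳ ((1# - σ) * L) * B)
          ≡⟨ *-assoc _ _ B ⟨
        expʳ ((fromℕ (suc k) * h - 1#) * L) * expʳ ((1# - σ) * L) * B
          ≡⟨ cong (λ t → t * B) (expʳ-+ _ _) ⟨
        -- The upper end of the layer is σ + h, so the two exponents cancel up to `h * L`, at most 1
        -- because L ≤ K.
        expʳ ((fromℕ (suc k) * h - 1#) * L + (1# - σ) * L) * B
          ≡⟨ cong (λ t → expʳ t * B) (width (fromℕ k) h L) ⟩
        expʳ (h * L) * B
          ≤⟨ *-monoʳ-≤ 0≤B (expʳ-mono hL≤1) ⟩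
        expʳ 1# * B ∎
        where
        σ = fromℕ k * h
        width : ∀ k h l → ((1# + k) * h - 1#) * l + (1# - k * h) * l ≡ h * l
        width = solve 3 (λ k h l → ((con (+ 1) :+ k) :* h :- con (+ 1)) :* l :+ (con (+ 1) :- k :* h) :* l := h :* l) refl

  upper-bound : ∀ x y → ∃[ z ] (x ≤ z × y ≤ z)
  upper-bound x y with ≤-total x y
  ... | inj₁ x≤y = y , x≤y , ≤-refl
  ... | inj₂ y≤x = x , ≤-refl , y≤x

  -- log is not known to invert expʳ here, whence the extra factor e.
  ^ʳ-suc-≥ : ∀ {L} c → 1# ≤ L → L ^ʳ c * L ≤ expʳ 1# * L ^ʳ (c + 1#)
  ^ʳ-suc-≥ {L} c 1≤L = begin
    L ^ʳ c * L                             ≤⟨ *-monoˡ-≤ (proj₁ (expʳ-pos (c * log L))) (≤expʳ-log 1≤L) ⟩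
    L ^ʳ c * (expʳ (log L) * expʳ 1#)      ≡⟨ rotate (L ^ʳ c) (expʳ (log L)) (expʳ 1#) ⟩
    expʳ 1# * (L ^ʳ c * expʳ (log L))      ≡⟨ cong (λ t → expʳ 1# * t) (expʳ-+ (c * log L) (log L)) ⟨
    expʳ 1# * expʳ (c * log L + log L)     ≡⟨ cong (λ t → expʳ 1# * expʳ t) (factor c (log L)) ⟩
    expʳ 1# * L ^ʳ (c + 1#)                ∎
    where
    open ≤-Reasoning
    rotate : ∀ p l e → p * (l * e) ≡ e * (p * l)
    rotate = solve 3 (λ p l e → p :* (l :* e) := e :* (p :* l)) refl
    factor : ∀ c l → c * l + l ≡ (c + 1#) * l
    factor = solve 2 (λ c l → c :* l :+ l := (c :+ con (+ 1)) :* l) refl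

proposition3p3 :
  (lem : ExcludedMiddle 0ℓ) (R : CompleteOrderedField) →
  let open Analysis lem R in
  (ζ : ℂ → ℂ) → IsRiemannZeta ζ →
  (T : ℝ → ℝ) → (∀ x → 0# < T x) →
  (M N : ℝ → ℝ) (a b : ℝ → ℕ → ℝ) →
  (∀ x m → m ∼ M x → 0# ≤ a x m × a x m ≤ 1#) →
  (∀ x n → n ∼ N x → 0# ≤ b x n × b x n ≤ 1#) →
  let MN : ℝ → ℂ → ℝ
      MN x ρ = ∥ dirichletPoly (M x) (a x) ρ *ᶜ dirichletPoly (N x) (b x) ρ ∥ in
  (c : ℝ) →
  (∃[ C ] ∃[ x₀ ] ∀ x → x₀ ≤ x → ∀ σ → 0# ≤ σ → σ ≤ 1# →
    ZeroSumAtMost ζ (λ ρ → σ ≤ re ρ × ∣ im ρ ∣ ≤ T x)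
      (λ ρ → MN x ρ)
      (C * (x ^ʳ (1# - σ) * log x ^ʳ c))) →
  ∃[ C ] ∃[ x₀ ] ∀ x → x₀ ≤ x →
    ZeroSumAtMost ζ (λ ρ → ∣ im ρ ∣ ≤ T x)
      (λ ρ → x ^ʳ (re ρ - 1#) * MN x ρ)
      (C * log x ^ʳ (c + 1#))
-- In the constant, `two * e` comes from the number of layers and their width, and the second `e`
-- from `^ʳ-suc-≥`.
proposition3p3 lem R ζ _ T _ M N a b _ _ c (C , x₀ , bound) = two * e * (C * e) , x₁ , λ x x₁≤x →
  bounded⇒sum {P = Zero x} λ l unique all → ≤-trans
    (exp-weighted-sum-≤ β-pos β≤1 (0≤F x) (1≤L x₁≤x) (tail-bound x₁≤x) l unique all)
    (constant x₁≤x)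
  where
  open Analysis lem R
  open OrderedField lem R
  open RealAnalysis lem R
  e = expʳ 1#
  -- Beyond e one has `1# ≤ log x`, as the choice of the number of layers demands.
  x₁ = proj₁ (upper-bound x₀ e)
  x₀≤x₁ = proj₁ (proj₂ (upper-bound x₀ e))
  e≤x₁ = proj₂ (proj₂ (upper-bound x₀ e))
  Zero : ℝ → ℂ × ℕ → Set
  Zero x z = IsCountedZero ζ z × ∣ im (proj₁ z) ∣ ≤ T x
  β : ℂ × ℕ → ℝ
  β z = re (proj₁ z)
  F : ℝ → ℂ × ℕ → ℝ
  F x (ρ , _) = ∥ dirichletPoly (M x) (a x) ρ *ᶜ dirichletPoly (N x) (b x) ρ ∥
  0≤F : ∀ x z → 0# ≤ F x z
  0≤F x z = ∥∥-nonneg _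
  β-pos : ∀ {x z} → Zero x z → 0# < β z
  β-pos (((_ , 0<re , _) , _) , _) = 0<re
  β≤1 : ∀ {x z} → Zero x z → β z ≤ 1#
  β≤1 (((_ , _ , re<1) , _) , _) = proj₁ re<1
  1≤L : ∀ {x} → x₁ ≤ x → 1# ≤ log x
  1≤L x₁≤x = 1≤log (≤-trans e≤x₁ x₁≤x)
  swap : ∀ p q r → p * (q * r) ≡ q * (p * r)
  swap = solve 3 (λ p q r → p :* (q :* r) := q :* (p :* r)) refl
  tail-bound : ∀ {x} → x₁ ≤ x → ∀ σ → 0# ≤ σ → σ ≤ 1# →
    SumsBounded (λ z → Zero x z × σ ≤ β z) (F x) (x ^ʳ (1# - σ) * (C * log x ^ʳ c))
  tail-bound {x} x₁≤x σ 0≤σ σ≤1 l unique all =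
    subst (sumOver (F x) l ≤_) (swap C (x ^ʳ (1# - σ)) (log x ^ʳ c))
      (sum⇒bounded (bound x (≤-trans x₀≤x₁ x₁≤x) σ 0≤σ σ≤1) l unique
        (All.map (λ ((isZero , im≤T) , σ≤re) → isZero , σ≤re , im≤T) all))
  constant : ∀ {x} → x₁ ≤ x → two * e * (C * log x ^ʳ c) * log x ≤ two * e * (C * e) * log x ^ʳ (c + 1#)
  constant {x} x₁≤x = begin
    two * e * (C * log x ^ʳ c) * log x         ≡⟨ regroup (two * e) C (log x ^ʳ c) (log x) ⟩
    two * e * C * (log x ^ʳ c * log x)         ≤⟨ *-monoˡ-≤ (*-nonneg (*-nonneg (proj₁ 0<2) (proj₁ (expʳ-pos 1#))) 0≤C)
                                                    (^ʳ-suc-≥ c (1≤L x₁≤x)) ⟩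
    two * e * C * (e * log x ^ʳ (c + 1#))      ≡⟨ regroup (two * e) C e (log x ^ʳ (c + 1#)) ⟨
    two * e * (C * e) * log x ^ʳ (c + 1#)      ∎
    where
    open ≤-Reasoning
    regroup : ∀ k c p q → k * (c * p) * q ≡ k * c * (p * q)
    regroup = solve 4 (λ k c p q → k :* (c :* p) :* q := k :* c :* (p :* q)) refl
    0≤C : 0# ≤ C
    -- The tail bound at σ = 1 gives 0 ≤ C * log x ^ʳ c, and the power is positive.
    0≤C = *-cancelˡ-≤ (expʳ-pos (c * log (log x))) (subst₂ _≤_ (sym (zeroʳ (log x ^ʳ c))) (*-comm C (log x ^ʳ c))
      (tail-constant-nonneg (tail-bound x₁≤x 1# 0≤1 ≤-refl)))
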